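{- There is a universal constant $c>0$ such that for every real $I\ge 1$, all finite sets $\mathcal X,\mathcal Y$, every Boolean function $f:\mathcal X\times\mathcal Y\to\{0,1\}$, and every protocol distribution $p(xym)$ of communication complexity $C$ (with $xy\in\mathcal X\times\mathcal Y$), $$\mathsf M_I(p,f)\ \le\ 2C-\Big(1+\frac{12}{\delta}\Big)\cdot I\cdot\log\Big(\mathbb E_{p(m)}\Big|\mathbb E_{p(xy|m)}\big[(-1)^{f(xy)}\big]\Big|\Big)+c\,I,$$ where $\delta=1/15$.
   Context: All sets are finite, $xy$ means $(x,y)$, logs are base 2. For a joint distribution, e.g. $q(xym)$, we write $q(m),q(xy|m),q(x|ym)$, etc. for its marginals and conditionals. Protocol distribution: a distribution $p(xym)$ on inputs $xy\in\mathcal X\times\mathcal Y$ and $m=(m_0,m_1,m_2,\dots)$, where $m_0$ is the public randomness and $m_1,m_2,\dots$ are the messages (odd ones sent by Alice, even ones by Bob), such that $$p(xym)=p(xy)\cdot p(m_0)\cdot\prod_{i=1,3,5,\dots}p(m_i|xm_{<i})\cdot p(m_{i+1}|ym_{\le i}).$$ Its communication complexity is the maximum total number of bits in the messages $m_1,m_2,\dots$ ($m_0$ is not counted). A distribution $q(xym)$ is rectangular with respect to a distribution $\mu(xy)$ if $q(xym)=\mu(xy)\cdot A(xm)\cdot B(ym)$ for some functions $A,B$. Marginal information: for $I\ge1$ and $\delta=1/15$, $$\mathsf M_I(p,f)=\inf_q\sup_{xym}\log\Big(\frac{q(x|ym)}{p(x|y)}\cdot\frac{q(y|xm)}{p(y|x)}\cdot\Big(\frac{q(xym)}{p(xym)}\Big)^I\cdot\Big|\mathbb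 E_{q(xy|m)}[(-1)^{f(xy)}]\Big|^{ -12I/\delta}\Big),$$ where the infimum is over all distributions $q$ that are rectangular with respect to $p(xy)$, and the supremum is over all $xym$ in the support of $q$. (Division by $0$, or a negative power of $0$, is read as $+\infty$; $-\log 0=+\infty$.)
   Formalization: Messages are assumed self-delimiting (given the earlier transcript, no possible next message is a proper prefix of another); otherwise one bit sent in the x-th of many otherwise empty rounds reveals x with C=1 and the bound fails. -}

module Defs where

open import Algebra.Bundles using (CommutativeRing)
open import Axiom.ExcludedMiddle using (ExcludedMiddle)
open import Data.Bool.Base using (Bool; true; false; _∧_; if_then_else_)
open import Data.Fin.Base using (Fin; toℕ)
import Data.Bool.Properties as Bool
import Data.Fin.Properties as Fin
open import Data.List.Base
  using (List; []; _∷_; _++_; length; map; foldr; take; upTo; allFin; cartesianProduct; cartesianProductWith)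
import Data.List.Properties as List
open import Data.List.Relation.Binary.Prefix.Heterogeneous using (Prefix)
open import Data.Nat.Base as ℕ using (ℕ; zero; suc; parity)
open import Data.Parity.Base using (Parity; 0ℙ; 1ℙ)
open import Data.Product.Base using (∃; ∃-syntax; Σ-syntax; _×_; _,_; proj₁; proj₂)
open import Data.Sum.Base using (_⊎_)
open import Data.Vec.Base as Vec using (Vec; []; _∷_; lookup; toList)
open import Function.Base using (_∘_)
open import Level using (0ℓ)
import Relation.Binary.Construct.Add.Extrema.NonStrict as ExtendedOrder
import Relation.Binary.Construct.Add.Supremum.NonStrict as Sup
open import Relation.Binary.Core using (Rel)
open import Relation.Binary.Definitions using (Decidable; DecidableEquality)
open import Relation.Binary.PropositionalEquality using (_≡_; refl; cong)
open import Relation.Binary.Structures using (IsStrictTotalOrder)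
open import Relation.Nullary using (¬_; Dec; yes; no; does; contradiction)
open import Relation.Nullary.Construct.Add.Extrema using (_±; ⊥±; ⊤±; [_])
open import Relation.Nullary.Decidable using (_×-dec_; map′)
open import Relation.Unary using (Pred)

------------------------------------------------------------------------
-- The real numbers, axiomatically: a Dedekind-complete ordered field with
-- the base-2 exponential and logarithm.  All of these are determined by
-- the axioms up to unique isomorphism, except for the irrelevant values
-- 0# ⁻¹ and log₂ x for x ≤ 0#.  Equality is a setoid equality so that
-- Cauchy sequences or Dedekind cuts are models without extensionality.

record RealNumbers : Set₁ where
  field
    commutativeRing : CommutativeRing 0ℓ 0ℓ

  open CommutativeRing commutativeRing public
    using (Carrier; _≈_; _+_; _*_; -_; _-_; 0#; 1#)

  infix 4 _<_ _≤_
  infix 9 _⁻¹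
  infixr 9 2^_

  field
    _<_                : Rel Carrier 0ℓ
    isStrictTotalOrder : IsStrictTotalOrder _≈_ _<_
    0<1                : 0# < 1#
    +-monoʳ-<          : ∀ x {y z} → y < z → x + y < x + z
    *-pos              : ∀ {x y} → 0# < x → 0# < y → 0# < x * y

    _⁻¹         : Carrier → Carrier
    ⁻¹-cong     : ∀ {x y} → x ≈ y → x ⁻¹ ≈ y ⁻¹
    ⁻¹-inverseʳ : ∀ {x} → ¬ (x ≈ 0#) → x * x ⁻¹ ≈ 1#

  _≤_ : Rel Carrier 0ℓ
  x ≤ y = x < y ⊎ x ≈ y

  field
    complete : (S : Pred Carrier 0ℓ) → ∃ S → (∃[ b ] ∀ x → S x → x ≤ b) →
               ∃[ s ] ((∀ x → S x → x ≤ s) × (∀ b → (∀ x → S x → x ≤ b) → s ≤ b))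

    2^_       : Carrier → Carrier
    2^-cong   : ∀ {x y} → x ≈ y → 2^ x ≈ 2^ y
    2^-homo-+ : ∀ x y → 2^ (x + y) ≈ 2^ x * 2^ y
    2^1       : 2^ 1# ≈ 1# + 1#
    2^-mono-< : ∀ {x y} → x < y → 2^ x < 2^ y

    log₂      : Carrier → Carrier
    log₂-cong : ∀ {x y} → x ≈ y → log₂ x ≈ log₂ y
    2^log₂    : ∀ {x} → 0# < x → 2^ (log₂ x) ≈ x

  open IsStrictTotalOrder isStrictTotalOrder public using (compare; _<?_)

------------------------------------------------------------------------
-- Bit strings of length at most L, and transcripts.

data Message : ℕ → Set where
  ε   : ∀ {L} → Message L
  _∷_ : ∀ {L} → Bool → Message L → Message (suc L)

bits : ∀ {L} → Message L → List Bool
bits ε       = []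
bits (b ∷ s) = b ∷ bits s

bits-injective : ∀ {L} {s t : Message L} → bits s ≡ bits t → s ≡ t
bits-injective {s = ε}     {ε}     _  = refl
bits-injective {s = b ∷ s} {c ∷ t} eq with List.∷-injective eq
... | refl , eq′ = cong (b ∷_) (bits-injective eq′)

_≟ᴹ_ : ∀ {L} → DecidableEquality (Message L)
s ≟ᴹ t = map′ bits-injective (cong bits) (List.≡-dec Bool._≟_ (bits s) (bits t))

allMessages : ∀ L → List (Message L)
allMessages zero    = ε ∷ []
allMessages (suc L) =
  ε ∷ map (false ∷_) (allMessages L) ++ map (true ∷_) (allMessages L)

allVecs : ∀ {A : Set} → List A → ∀ n → List (Vec A n)
allVecs xs zero    = [] ∷ []
allVecs xs (suc n) = cartesianProductWith _∷_ xs (allVecs xs n)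

-- (m₀ , m₁ ∷ m₂ ∷ … ∷ m_T): public randomness from a k-element set,
-- followed by T messages.
Transcript : (k T L : ℕ) → Set
Transcript k T L = Fin k × Vec (Message L) T

allTranscripts : ∀ k T L → List (Transcript k T L)
allTranscripts k T L = cartesianProduct (allFin k) (allVecs (allMessages L) T)

message : ∀ {k T L} → Transcript k T L → Fin T → Message L
message (_ , ms) i = lookup ms i

-- m₀ is not counted.
bitLength : ∀ {k T L} → Transcript k T L → ℕ
bitLength (_ , ms) = Vec.sum (Vec.map (length ∘ bits) ms)

-- m and m′ agree on m₀, m₁, …, mᵢ.
AgreeUpTo : ∀ {k T L} → ℕ → Rel (Transcript k T L) 0ℓ
AgreeUpTo i (r , ms) (r′ , ms′) =
  r ≡ r′ × take i (toList ms) ≡ take i (toList ms′)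

agreeUpTo? : ∀ {k T L} i → Decidable (AgreeUpTo {k} {T} {L} i)
agreeUpTo? i (r , ms) (r′ , ms′) =
  (r Fin.≟ r′) ×-dec List.≡-dec _≟ᴹ_ (take i (toList ms)) (take i (toList ms′))

Outcome : (a b k T L : ℕ) → Set
Outcome a b k T L = Fin a × Fin b × Transcript k T L

allOutcomes : ∀ a b k T L → List (Outcome a b k T L)
allOutcomes a b k T L =
  cartesianProduct (allFin a) (cartesianProduct (allFin b) (allTranscripts k T L))

------------------------------------------------------------------------

module MarginalInformation (ℝ : RealNumbers) where

  open RealNumbers ℝ

  infixl 7 _/_
  _/_ : Carrier → Carrier → Carrier
  x / y = x * y ⁻¹

  ι : ℕ → Carrier
  ι zero    = 0#
  ι (suc n) = 1# + ι n

  ∣_∣ : Carrier → Carrier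
  ∣ x ∣ = if does (x <? 0#) then - x else x

  -- Real powers, meaningful for a positive base.
  infixr 8 _^_
  _^_ : Carrier → Carrier → Carrier
  x ^ y = 2^ (y * log₂ x)

  ∑ : {A : Set} → List A → (A → Carrier) → Carrier
  ∑ xs g = foldr _+_ 0# (map g xs)

  ∏ : {A : Set} → List A → (A → Carrier) → Carrier
  ∏ xs g = foldr _*_ 1# (map g xs)

  δ : Carrier
  δ = 1# / ι 15

  ----------------------------------------------------------------------
  -- Extended reals: -∞ is ⊥±, +∞ is ⊤±.

  open ExtendedOrder _≤_ public using (_≤±_)
  open ExtendedOrder _≤_ using (⊥±≤_; _≤⊤±; [_]; ⊤±≤⊤±)

  IsUpperBound IsLowerBound : Pred (Carrier ±) 0ℓ → Pred (Carrier ±) 0ℓ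
  IsUpperBound S v = ∀ w → S w → w ≤± v
  IsLowerBound S v = ∀ w → S w → v ≤± w

  IsSupremum IsInfimum : Pred (Carrier ±) 0ℓ → Pred (Carrier ±) 0ℓ
  IsSupremum S v = IsUpperBound S v × IsLowerBound (IsUpperBound S) v
  IsInfimum  S v = IsLowerBound S v × IsUpperBound (IsLowerBound S) v

  []≤[]⁻¹ : ∀ {x y} → [ x ] ≤± [ y ] → x ≤ y
  []≤[]⁻¹ [ x≤y ] = x≤y

  []≰⊥± : ∀ {x} → ¬ ([ x ] ≤± ⊥±)
  []≰⊥± Sup.[ () ]

  supremum : ExcludedMiddle 0ℓ → ∀ S → ∃ (IsSupremum S)
  supremum em S with em {S ⊤±}
  ... | yes ⊤∈S = ⊤± , (λ w _ → w ≤⊤±) , λ u ub → ub ⊤± ⊤∈S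
  ... | no  ⊤∉S with em {∃[ x ] S [ x ]}
  ...   | no  none = ⊥± , upper , λ u _ → ⊥±≤ u
    where
    upper : IsUpperBound S ⊥±
    upper ⊥±    _   = ⊥±≤ ⊥±
    upper [ x ] x∈S = contradiction (x , x∈S) none
    upper ⊤±    ⊤∈S = contradiction ⊤∈S ⊤∉S
  ...   | yes (x₀ , x₀∈S) with em {∃[ b ] ∀ x → S [ x ] → x ≤ b}
  ...     | no  unbounded = ⊤± , (λ w _ → w ≤⊤±) , least
    where
    least : IsLowerBound (IsUpperBound S) ⊤±
    least ⊥±    ub = contradiction (ub [ x₀ ] x₀∈S) []≰⊥±
    least [ b ] ub = contradiction (b , λ x x∈S → []≤[]⁻¹ (ub [ x ] x∈S)) unbounded
    least ⊤±    ub = ⊤±≤⊤±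
  ...     | yes bounded = [ s ] , upper , least
    where
    lub = complete (λ x → S [ x ]) (x₀ , x₀∈S) bounded
    s = proj₁ lub
    upper : IsUpperBound S [ s ]
    upper ⊥±    _   = ⊥±≤ [ s ]
    upper [ x ] x∈S = [ proj₁ (proj₂ lub) x x∈S ]
    upper ⊤±    ⊤∈S = contradiction ⊤∈S ⊤∉S
    least : IsLowerBound (IsUpperBound S) [ s ]
    least ⊥±    ub = contradiction (ub [ x₀ ] x₀∈S) []≰⊥±
    least [ b ] ub = [ proj₂ (proj₂ lub) b (λ x x∈S → []≤[]⁻¹ (ub [ x ] x∈S)) ]
    least ⊤±    ub = [ s ] ≤⊤±

  infimum : ExcludedMiddle 0ℓ → ∀ S → ∃ (IsInfimum S)
  infimum em S with supremum em (IsLowerBound S)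
  ... | v , upper , least = v , (λ w w∈S → least w (λ u u≤S → u≤S w w∈S)) , upper

  ⨆ ⨅ : ExcludedMiddle 0ℓ → Pred (Carrier ±) 0ℓ → Carrier ±
  ⨆ em S = proj₁ (supremum em S)
  ⨅ em S = proj₁ (infimum em S)

  infix 1 [_]if_else+∞
  [_]if_else+∞ : ∀ {P : Set} → Carrier → Dec P → Carrier ±
  [ v ]if P? else+∞ = if does P? then [ v ] else ⊤±

  ----------------------------------------------------------------------

  module _ {a b k T L : ℕ} where

    private
      M = Transcript k T L

    Event : Set
    Event = Outcome a b k T L → Bool

    infixr 6 _∩_
    _∩_ : Event → Event → Event
    (E ∩ G) ω = E ω ∧ G ω

    ⟨x=_⟩ : Fin a → Event
    ⟨x= x ⟩ (x′ , _ , _) = does (x Fin.≟ x′)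

    ⟨y=_⟩ : Fin b → Event
    ⟨y= y ⟩ (_ , y′ , _) = does (y Fin.≟ y′)

    -- ⟨m≤ i ∶ m ⟩ fixes (m₀ , m₁ , …, mᵢ).
    ⟨m≤_∶_⟩ : ℕ → M → Event
    ⟨m≤ i ∶ m ⟩ (_ , _ , m′) = does (agreeUpTo? i m m′)

    ⟨m=_⟩ : M → Event
    ⟨m= m ⟩ = ⟨m≤ T ∶ m ⟩

  record Distribution (a b k T L : ℕ) : Set where
    field
      mass        : Outcome a b k T L → Carrier
      nonNegative : ∀ ω → 0# ≤ mass ω
      total       : ∑ (allOutcomes a b k T L) mass ≈ 1#

  open Distribution public

  module _ {a b k T L : ℕ} where

    private
      D = Distribution a b k T L
      M = Transcript k T L
      F = Fin a → Fin b → Bool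

    ℙ : D → Event → Carrier
    ℙ p E = ∑ (allOutcomes a b k T L) λ ω → if E ω then mass p ω else 0#

    -- Meaningful only if ℙ p G is nonzero; the numerator, hence the
    -- quotient, is 0 otherwise.
    ℙ[_∣_]of_ : Event → Event → D → Carrier
    ℙ[ E ∣ G ]of p = ℙ p (E ∩ G) / ℙ p G

    -- The i-th factor is p(mᵢ₊₁ | x m≤ᵢ) or p(mᵢ₊₁ | y m≤ᵢ): for even i the
    -- message mᵢ₊₁ is Alice's.  When a condition has probability 0, both the
    -- factor and p(xym) are 0.
    protocolProduct : D → Fin a → Fin b → M → Carrier
    protocolProduct p x y m =
      ℙ p (⟨x= x ⟩ ∩ ⟨y= y ⟩) * ℙ p ⟨m≤ 0 ∶ m ⟩ * ∏ (upTo T) (λ i → factor i (parity i))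
      where
      factor : ℕ → Parity → Carrier
      factor i 0ℙ = ℙ[ ⟨m≤ suc i ∶ m ⟩ ∣ ⟨x= x ⟩ ∩ ⟨m≤ i ∶ m ⟩ ]of p
      factor i 1ℙ = ℙ[ ⟨m≤ suc i ∶ m ⟩ ∣ ⟨y= y ⟩ ∩ ⟨m≤ i ∶ m ⟩ ]of p

    -- Messages may vary in length, so counting their bits measures the
    -- communication only if they are self-delimiting: given the transcript
    -- so far, no possible next message is a proper prefix of another.
    -- (Otherwise information can be hidden for free in the choice of which
    -- messages are empty.)
    record IsProtocol (p : D) : Set where
      field
        factorises : ∀ x y m → mass p (x , y , m) ≈ protocolProduct p x y m
        prefixFree : ∀ m m′ (i : Fin T) →
                     0# < ℙ p ⟨m= m ⟩ → 0# < ℙ p ⟨m= m′ ⟩ →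
                     AgreeUpTo (toℕ i) m m′ →
                     Prefix _≡_ (bits (message m i)) (bits (message m′ i)) →
                     message m i ≡ message m′ i

    record HasCommunicationComplexity (p : D) (C : ℕ) : Set where
      field
        bound    : ∀ m → 0# < ℙ p ⟨m= m ⟩ → bitLength m ℕ.≤ C
        attained : ∃[ m ] 0# < ℙ p ⟨m= m ⟩ × bitLength m ≡ C

    IsRectangular : D → (Fin a → Fin b → Carrier) → Set
    IsRectangular q μ =
      Σ[ A ∈ (Fin a → M → Carrier) ] Σ[ B ∈ (Fin b → M → Carrier) ]
        ∀ x y m → mass q (x , y , m) ≈ μ x y * A x m * B y m

    sign : Bool → Carrier
    sign false = 1#
    sign true  = - 1#

    -- 𝔼_{q(xy|m)} [(-1)^f(xy)]
    bias : D → F → M → Carrier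
    bias q f m =
      ∑ (allFin a) λ x → ∑ (allFin b) λ y →
        ℙ[ ⟨x= x ⟩ ∩ ⟨y= y ⟩ ∣ ⟨m= m ⟩ ]of q * sign (f x y)

    -- 𝔼_{p(m)} |𝔼_{p(xy|m)} [(-1)^f(xy)]|
    advantage : D → F → Carrier
    advantage p f = ∑ (allTranscripts k T L) λ m → ℙ p ⟨m= m ⟩ * ∣ bias p f m ∣

    -- The expression inside the supremum.  It is only evaluated on the
    -- support of q, where it is +∞ exactly if a denominator or the base of
    -- the negative power vanishes.
    logCost : Carrier → D → F → D → Outcome a b k T L → Carrier ±
    logCost I p f q (x , y , m) =
      [ log₂ ( qx∣ym / px∣y
             * (qy∣xm / py∣x)
             * (mass q (x , y , m) / mass p (x , y , m)) ^ I
             * ∣ bias q f m ∣ ^ (- (ι 12 * I / δ))) ]if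
        (0# <? px∣y) ×-dec (0# <? py∣x) ×-dec
        (0# <? mass p (x , y , m)) ×-dec (0# <? ∣ bias q f m ∣)
      else+∞
      where
      px∣y  = ℙ[ ⟨x= x ⟩ ∣ ⟨y= y ⟩ ]of p
      py∣x  = ℙ[ ⟨y= y ⟩ ∣ ⟨x= x ⟩ ]of p
      qx∣ym = ℙ[ ⟨x= x ⟩ ∣ ⟨y= y ⟩ ∩ ⟨m= m ⟩ ]of q
      qy∣xm = ℙ[ ⟨y= y ⟩ ∣ ⟨x= x ⟩ ∩ ⟨m= m ⟩ ]of q

    marginalInformation : ExcludedMiddle 0ℓ → Carrier → D → F → Carrier ±
    marginalInformation em I p f =
      ⨅ em λ v → Σ[ q ∈ D ]
        IsRectangular q (λ x y → ℙ p (⟨x= x ⟩ ∩ ⟨y= y ⟩)) ×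
        v ≡ ⨆ em (λ w → ∃[ ω ] 0# < mass q ω × w ≡ logCost I p f q ω)

-- Reweight the protocol to q(m) ∝ p(m) h(m), where h(m) is the bias at m, and
-- keep only transcripts with q(m) at least a quarter of both p(m) and
-- p(m₀) 2^{-C}.  By Kraft's inequality this discards at most half of q, so
-- p(m₀) ≤ 4 · 2^C q(m), and h(m) ≥ ε/4, where ε is the advantage of p.
-- Given m, restrict (x, y) to a rectangle R that maximises E²/μ, where μ is the
-- mass of R and E the signed mass, and then to a subrectangle in which every row
-- and every column has mass at least μ/32 times its prior.  The latter bounds
-- the ratios q(x|ym)/p(x|y) and q(y|xm)/p(y|x) by 32 p(m₀)/μ.  A small μ makes
-- these ratios large, but the maximality of E²/μ makes the bias E/μ of q grow at
-- least like μ^{-1/2}, and its power 12 I/δ = 180 I more than pays for them.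

module Submission where

open import Defs
open import Algebra.Bundles using (CommutativeRing)
import Algebra.Properties.Ring as RingProperties
import Algebra.Solver.Ring as RingSolver
open import Algebra.Solver.Ring.AlmostCommutativeRing
  using (AlmostCommutativeRing; fromCommutativeRing; _-Raw-AlmostCommutative⟶_)
open import Axiom.ExcludedMiddle using (ExcludedMiddle)
open import Data.Bool.Base using (Bool; true; false; _∧_; not; if_then_else_)
import Data.Bool.Properties as Bool
open import Data.Fin.Base using (Fin; zero; suc; toℕ)
import Data.Fin.Properties as Fin
open import Data.Integer.Base as ℤ using (ℤ; +_; -[1+_])
import Data.Integer.Properties as ℤ
open import Data.List.Base using (List; []; _∷_; _++_; map; length; take; allFin; upTo; cartesianProductWith)
import Data.List.Properties as List
open import Data.List.Membership.Propositional using (_∈_)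
open import Data.List.Membership.Propositional.Properties
  using (∈-allFin; ∈-map⁺; ∈-map⁻; ∈-++⁺ˡ; ∈-++⁺ʳ; ∈-++⁻; ∈-cartesianProductWith⁺; ∈-cartesianProduct⁺)
open import Data.List.Relation.Binary.Disjoint.Propositional using (Disjoint)
open import Data.List.Relation.Binary.Prefix.Heterogeneous using (Prefix; []; _∷_)
open import Data.List.Relation.Unary.All as All using (All; []; _∷_)
open import Data.List.Relation.Unary.All.Properties using (¬Any⇒All¬)
open import Data.List.Relation.Unary.AllPairs using ([]; _∷_)
open import Data.List.Relation.Unary.Any using (here; there)
open import Data.List.Relation.Unary.Unique.Propositional using (Unique)
import Data.List.Relation.Unary.Unique.Propositional.Properties as Unique
open import Data.Maybe.Base using (Maybe; just; nothing)
open import Data.Nat.Base as ℕ using (ℕ; zero; suc; parity)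
import Data.Nat.Properties as ℕ
open import Data.Parity.Base using (Parity; 0ℙ; 1ℙ)
open import Data.Product.Base using (Σ-syntax; ∃; ∃-syntax; ∃₂; _×_; _,_; proj₁; proj₂)
open import Data.Sum.Base using (inj₁; inj₂)
open import Data.Vec.Base as Vec using (Vec; []; _∷_; lookup; toList)
open import Data.Vec.Functional using () renaming (_∷_ to _∷ᶠ_)
import Data.Vec.Properties as Vec
open import Function.Base using (_∘_)
open import Level using (0ℓ)
open import Relation.Binary.Bundles using (StrictPartialOrder)
import Relation.Binary.Construct.Add.Extrema.NonStrict as ExtendedOrder
open import Relation.Binary.Definitions using (tri<; tri≈; tri>)
open import Relation.Binary.PropositionalEquality as ≡ using (_≡_; _≢_; _≗_)
import Relation.Binary.Reasoning.Setoid
import Relation.Binary.Reasoning.StrictPartialOrder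
open import Relation.Binary.Structures using (IsStrictTotalOrder)
open import Relation.Nullary using (¬_; Dec; yes; no; does; contradiction)
open import Relation.Nullary.Construct.Add.Extrema using (_±; [_])
open import Relation.Nullary.Decidable using (_×-dec_; dec-true)
open import Relation.Unary using (Pred)

-- The obstacle is cancellation: deleting light rows and columns removes little mass, yet the
-- deleted part could carry all of the signed mass E. Maximality of E²/μ excludes this. The deleted
-- part consists of two strips that are rectangles themselves, so each satisfies E² ≤ V μ with the
-- same maximum V, and little mass means little signed mass. Maximising |E|/μ instead would be
-- content with a single entry, where the bias is 1 but μ is arbitrarily small. The threshold
-- against p(m₀) 2^(-C) is needed because p(xym) is only bounded by p(xy) p(m₀): it is p(m₀), not
-- p(m), that enters the two ratios. No lower bound on μ is ever proved. With ε the advantage, B the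
-- absolute bias of q at m and H = p(m) h(m), the choice of rectangle gives ε H ≤ 16 B² μ, which
-- eliminates μ: both ratios divided by 2^C, and also q(xym)/p(xym), are at most a constant times
-- B²/ε². This costs B^(4 + 2 I) against the available B^(-180 I), and the remaining negative power
-- of B is bounded by B ≥ ε/8.

-- Ordered field arithmetic, polynomial identities and base-2 logarithms.

module OrderedField (ℝ : RealNumbers) where

  open RealNumbers ℝ
  open MarginalInformation ℝ
  open CommutativeRing commutativeRing public
    using (refl; sym; trans; reflexive; +-cong; +-congˡ; +-congʳ; *-cong; *-congˡ; *-congʳ; -‿cong
          ; +-assoc; +-comm; +-identityˡ; +-identityʳ; *-assoc; *-comm
          ; *-identityˡ; *-identityʳ; zeroˡ; zeroʳ; distribˡ; distribʳ
          ; -‿inverseˡ; -‿inverseʳ)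
  open RingProperties (CommutativeRing.ring commutativeRing) public
    using (-‿distribˡ-*; -‿distribʳ-*; -‿involutive; -0#≈0#)
  open IsStrictTotalOrder isStrictTotalOrder public
    using (isStrictPartialOrder; irrefl; <-respʳ-≈; <-respˡ-≈)
    renaming (trans to <-trans)

  strictPartialOrder : StrictPartialOrder 0ℓ 0ℓ 0ℓ
  strictPartialOrder = record { isStrictPartialOrder = isStrictPartialOrder }

  module R = Relation.Binary.Reasoning.StrictPartialOrder strictPartialOrder

  open RingProperties (CommutativeRing.ring commutativeRing) using (-‿+-comm)

  ι-+ : ∀ m n → ι (m ℕ.+ n) ≈ ι m + ι n
  ι-+ zero    n = sym (+-identityˡ _)
  ι-+ (suc m) n = trans (+-congˡ (ι-+ m n)) (sym (+-assoc _ _ _))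

  ι-* : ∀ m n → ι (m ℕ.* n) ≈ ι m * ι n
  ι-* zero    n = sym (zeroˡ _)
  ι-* (suc m) n = trans (ι-+ n (m ℕ.* n))
    (trans (+-cong (sym (*-identityˡ _)) (ι-* m n)) (sym (distribʳ _ _ _)))

  -- Integers serve as solver coefficients because their equality is decidable, which that of the
  -- reals need not be. As `ιℤ (+ n)` unfolds to `ι n`, solver constants match the numerals of the
  -- goals.
  ιℤ : ℤ → Carrier
  ιℤ (+ n)    = ι n
  ιℤ -[1+ n ] = - ι (suc n)

  cancel-1 : ∀ x y → (1# + x) - (1# + y) ≈ x - y
  cancel-1 x y = begin
    (1# + x) - (1# + y)        ≈⟨ +-cong (+-comm _ _) (sym (-‿+-comm 1# y)) ⟩
    (x + 1#) + (- 1# + - y)    ≈⟨ +-assoc _ _ _ ⟩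
    x + (1# + (- 1# + - y))    ≈⟨ +-congˡ (sym (+-assoc _ _ _)) ⟩
    x + ((1# + - 1#) + - y)    ≈⟨ +-congˡ (+-congʳ (-‿inverseʳ 1#)) ⟩
    x + (0# + - y)             ≈⟨ +-congˡ (+-identityˡ _) ⟩
    x - y                      ∎
    where open Relation.Binary.Reasoning.Setoid (CommutativeRing.setoid commutativeRing)

  ιℤ-⊖ : ∀ m n → ιℤ (m ℤ.⊖ n) ≈ ι m - ι n
  ιℤ-⊖ m       zero    = sym (trans (+-congˡ -0#≈0#) (+-identityʳ _))
  ιℤ-⊖ zero    (suc n) = sym (+-identityˡ _)
  ιℤ-⊖ (suc m) (suc n) =
    trans (reflexive (≡.cong ιℤ (ℤ.[1+m]⊖[1+n]≡m⊖n m n)))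
      (trans (ιℤ-⊖ m n) (sym (cancel-1 _ _)))

  ιℤ-+ : ∀ i j → ιℤ (i ℤ.+ j) ≈ ιℤ i + ιℤ j
  ιℤ-+ (+ m)    (+ n)    = ι-+ m n
  ιℤ-+ (+ m)    -[1+ n ] = ιℤ-⊖ m (suc n)
  ιℤ-+ -[1+ m ] (+ n)    = trans (ιℤ-⊖ n (suc m)) (+-comm _ _)
  ιℤ-+ -[1+ m ] -[1+ n ] =
    trans (-‿cong (trans (reflexive (≡.cong ι (≡.sym (≡.cong suc (ℕ.+-suc m n))))) (ι-+ (suc m) (suc n))))
          (sym (-‿+-comm _ _))

  ιℤ-neg : ∀ i → ιℤ (ℤ.- i) ≈ - ιℤ i
  ιℤ-neg (+ zero)  = sym -0#≈0#
  ιℤ-neg (+ suc n) = refl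
  ιℤ-neg -[1+ n ]  = sym (-‿involutive _)

  ιℤ-+*+ : ∀ m n → ιℤ (+ m ℤ.* + n) ≈ ι m * ι n
  ιℤ-+*+ m n = trans (reflexive (≡.cong ιℤ (≡.sym (ℤ.pos-* m n)))) (ι-* m n)

  ιℤ-* : ∀ i j → ιℤ (i ℤ.* j) ≈ ιℤ i * ιℤ j
  ιℤ-* (+ m)    (+ n)    = ιℤ-+*+ m n
  ιℤ-* (+ m)    -[1+ n ] = trans (reflexive (≡.cong ιℤ (≡.sym (ℤ.neg-distribʳ-* (+ m) (+ suc n)))))
    (trans (ιℤ-neg (+ m ℤ.* + suc n)) (trans (-‿cong (ιℤ-+*+ m (suc n))) (-‿distribʳ-* _ _)))
  ιℤ-* -[1+ m ] (+ n)    = trans (reflexive (≡.cong ιℤ (≡.sym (ℤ.neg-distribˡ-* (+ suc m) (+ n)))))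
    (trans (ιℤ-neg (+ suc m ℤ.* + n)) (trans (-‿cong (ιℤ-+*+ (suc m) n)) (-‿distribˡ-* _ _)))
  ιℤ-* -[1+ m ] -[1+ n ] = trans (ι-* (suc m) (suc n))
    (trans (sym (-‿involutive _)) (trans (-‿cong (-‿distribˡ-* _ _)) (-‿distribʳ-* _ _)))

  almostCommutativeRing : AlmostCommutativeRing 0ℓ 0ℓ
  almostCommutativeRing = fromCommutativeRing commutativeRing

  ℤ⟶ℝ : ℤ.+-*-rawRing -Raw-AlmostCommutative⟶ almostCommutativeRing
  ℤ⟶ℝ = record
    { ⟦_⟧ = ιℤ ; +-homo = ιℤ-+ ; *-homo = ιℤ-* ; -‿homo = ιℤ-neg
    ; 0-homo = refl ; 1-homo = +-identityʳ 1# }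

  coefficient≟ : ∀ i j → Maybe (ιℤ i ≈ ιℤ j)
  coefficient≟ i j with i ℤ.≟ j
  ... | yes i≡j = just (reflexive (≡.cong ιℤ i≡j))
  ... | no  _   = nothing

  open RingSolver ℤ.+-*-rawRing almostCommutativeRing ℤ⟶ℝ coefficient≟ public
    using (solve; _:=_; _:+_; _:*_; _:-_; :-_; con)

  infix 4 _≤?_

  ≤-refl : ∀ {x} → x ≤ x
  ≤-refl = inj₂ refl

  ≤-trans : ∀ {x y z} → x ≤ y → y ≤ z → x ≤ z
  ≤-trans x≤y y≤z = R.begin _ R.≤⟨ x≤y ⟩ _ R.≤⟨ y≤z ⟩ _ R.∎

  <-≤-trans : ∀ {x y z} → x < y → y ≤ z → x < z
  <-≤-trans x<y y≤z = R.begin-strict _ R.<⟨ x<y ⟩ _ R.≤⟨ y≤z ⟩ _ R.∎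

  ≤-<-trans : ∀ {x y z} → x ≤ y → y < z → x < z
  ≤-<-trans x≤y y<z = R.begin-strict _ R.≤⟨ x≤y ⟩ _ R.<⟨ y<z ⟩ _ R.∎

  ≤-resp-≈ : ∀ {x x′ y y′} → x ≈ x′ → y ≈ y′ → x ≤ y → x′ ≤ y′
  ≤-resp-≈ x≈x′ y≈y′ x≤y = ≤-trans (inj₂ (sym x≈x′)) (≤-trans x≤y (inj₂ y≈y′))

  <⇒≱ : ∀ {x y} → x < y → ¬ y ≤ x
  <⇒≱ x<y y≤x = irrefl refl (<-≤-trans x<y y≤x)

  ≮⇒≥ : ∀ {x y} → ¬ x < y → y ≤ x
  ≮⇒≥ {x} {y} x≮y with compare x y
  ... | tri< x<y _ _ = contradiction x<y x≮y
  ... | tri≈ _ x≈y _ = inj₂ (sym x≈y)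
  ... | tri> _ _ y<x = inj₁ y<x

  ≤-antisym : ∀ {x y} → x ≤ y → y ≤ x → x ≈ y
  ≤-antisym (inj₂ x≈y) _   = x≈y
  ≤-antisym (inj₁ x<y) y≤x = contradiction y≤x (<⇒≱ x<y)

  _≤?_ : ∀ x y → Dec (x ≤ y)
  x ≤? y with y <? x
  ... | yes y<x = no (<⇒≱ y<x)
  ... | no  y≮x = yes (≮⇒≥ y≮x)

  +-monoʳ-≤ : ∀ x {y z} → y ≤ z → x + y ≤ x + z
  +-monoʳ-≤ x (inj₁ y<z) = inj₁ (+-monoʳ-< x y<z)
  +-monoʳ-≤ x (inj₂ y≈z) = inj₂ (+-congˡ y≈z)

  +-mono-≤ : ∀ {x y u v} → x ≤ y → u ≤ v → x + u ≤ y + v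
  +-mono-≤ {x} {y} {u} {v} x≤y u≤v = R.begin
    x + u  R.≤⟨ +-monoʳ-≤ x u≤v ⟩
    x + v  R.≈⟨ +-comm x v ⟩
    v + x  R.≤⟨ +-monoʳ-≤ v x≤y ⟩
    v + y  R.≈⟨ +-comm v y ⟩
    y + v  R.∎

  +-nonNeg : ∀ {x y} → 0# ≤ x → 0# ≤ y → 0# ≤ x + y
  +-nonNeg 0≤x 0≤y = ≤-trans (inj₂ (sym (+-identityˡ 0#))) (+-mono-≤ 0≤x 0≤y)

  +-pos-nonNeg : ∀ {x y} → 0# < x → 0# ≤ y → 0# < x + y
  +-pos-nonNeg {x} 0<x 0≤y = <-≤-trans 0<x
    (≤-trans (inj₂ (sym (+-identityʳ x))) (+-monoʳ-≤ x 0≤y))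

  *-nonNeg : ∀ {x y} → 0# ≤ x → 0# ≤ y → 0# ≤ x * y
  *-nonNeg (inj₁ 0<x) (inj₁ 0<y) = inj₁ (*-pos 0<x 0<y)
  *-nonNeg (inj₂ 0≈x) _          = inj₂ (sym (trans (*-congʳ (sym 0≈x)) (zeroˡ _)))
  *-nonNeg (inj₁ _)   (inj₂ 0≈y) = inj₂ (sym (trans (*-congˡ (sym 0≈y)) (zeroʳ _)))

  -- Inequalities are mostly proved by exhibiting the difference of the two
  -- sides as a nonnegative expression and leaving the identity to the solver.
  ≤-by : ∀ {x y} d → 0# ≤ d → x + d ≈ y → x ≤ y
  ≤-by {x} d 0≤d x+d≈y =
    ≤-resp-≈ (+-identityʳ x) x+d≈y (+-monoʳ-≤ x 0≤d)

  <-by : ∀ {x y} d → 0# < d → x + d ≈ y → x < y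
  <-by {x} d 0<d x+d≈y =
    <-respʳ-≈ x+d≈y (<-respˡ-≈ (+-identityʳ x) (+-monoʳ-< x 0<d))

  x≤y⇒0≤y-x : ∀ {x y} → x ≤ y → 0# ≤ y - x
  x≤y⇒0≤y-x {x} {y} x≤y = ≤-resp-≈
    (-‿inverseˡ x) (+-comm (- x) y) (+-monoʳ-≤ (- x) x≤y)

  x<y⇒0<y-x : ∀ {x y} → x < y → 0# < y - x
  x<y⇒0<y-x {x} {y} x<y = <-respʳ-≈ (+-comm (- x) y)
    (<-respˡ-≈ (-‿inverseˡ x) (+-monoʳ-< (- x) x<y))

  *-monoˡ-≤ : ∀ {x y z} → 0# ≤ z → x ≤ y → z * x ≤ z * y
  *-monoˡ-≤ {x} {y} {z} 0≤z x≤y = ≤-by (z * (y - x)) (*-nonNeg 0≤z (x≤y⇒0≤y-x x≤y))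
    (solve 3 (λ x y z → z :* x :+ z :* (y :- x) := z :* y) refl x y z)

  *-monoʳ-≤ : ∀ {x y z} → 0# ≤ z → x ≤ y → x * z ≤ y * z
  *-monoʳ-≤ 0≤z x≤y = ≤-resp-≈ (*-comm _ _) (*-comm _ _) (*-monoˡ-≤ 0≤z x≤y)

  *-mono-≤ : ∀ {x y u v} → 0# ≤ u → 0# ≤ y → x ≤ y → u ≤ v → x * u ≤ y * v
  *-mono-≤ 0≤u 0≤y x≤y u≤v = ≤-trans (*-monoʳ-≤ 0≤u x≤y) (*-monoˡ-≤ 0≤y u≤v)

  *-monoˡ-< : ∀ {x y z} → 0# < z → x < y → z * x < z * y
  *-monoˡ-< {x} {y} {z} 0<z x<y = <-by (z * (y - x)) (*-pos 0<z (x<y⇒0<y-x x<y))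
    (solve 3 (λ x y z → z :* x :+ z :* (y :- x) := z :* y) refl x y z)

  *-cancelˡ-≤ : ∀ {x y z} → 0# < z → z * x ≤ z * y → x ≤ y
  *-cancelˡ-≤ 0<z zx≤zy = ≮⇒≥ λ y<x → <⇒≱ (*-monoˡ-< 0<z y<x) zx≤zy

  *-cancelˡ-pos : ∀ {x z} → 0# ≤ z → 0# < z * x → 0# < x
  *-cancelˡ-pos {x} {z} 0≤z 0<zx with 0# <? x
  ... | yes 0<x = 0<x
  ... | no  0≮x = contradiction
    (≤-trans (*-monoˡ-≤ 0≤z (≮⇒≥ 0≮x)) (inj₂ (zeroʳ z))) (<⇒≱ 0<zx)

  *-cancelʳ-pos : ∀ {x z} → 0# ≤ z → 0# < x * z → 0# < x
  *-cancelʳ-pos 0≤z 0<xz = *-cancelˡ-pos 0≤z (<-respʳ-≈ (*-comm _ _) 0<xz)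

  square-nonNeg : ∀ x → 0# ≤ x * x
  square-nonNeg x with compare 0# x
  ... | tri< 0<x _ _ = inj₁ (*-pos 0<x 0<x)
  ... | tri≈ _ 0≈x _ = *-nonNeg (inj₂ 0≈x) (inj₂ 0≈x)
  ... | tri> _ _ x<0 = ≤-resp-≈ refl
    (solve 1 (λ x → (con (+ 0) :- x) :* (con (+ 0) :- x) := x :* x) refl x)
    (*-nonNeg (inj₁ 0<-x) (inj₁ 0<-x))
    where 0<-x = x<y⇒0<y-x x<0

  pos⇒≉0 : ∀ {x} → 0# < x → ¬ x ≈ 0#
  pos⇒≉0 0<x x≈0 = irrefl (sym x≈0) 0<x

  ι-nonNeg : ∀ n → 0# ≤ ι n
  ι-nonNeg zero    = ≤-refl
  ι-nonNeg (suc n) = +-nonNeg (inj₁ 0<1) (ι-nonNeg n)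

  ι-pos : ∀ n → 0# < ι (suc n)
  ι-pos n = +-pos-nonNeg 0<1 (ι-nonNeg n)

  x*x⁻¹≈1 : ∀ {x} → 0# < x → x * x ⁻¹ ≈ 1#
  x*x⁻¹≈1 0<x = ⁻¹-inverseʳ (pos⇒≉0 0<x)

  ⁻¹-pos : ∀ {x} → 0# < x → 0# < x ⁻¹
  ⁻¹-pos 0<x = *-cancelˡ-pos (inj₁ 0<x) (<-respʳ-≈ (sym (x*x⁻¹≈1 0<x)) 0<1)

  /-cancel : ∀ {x z} → 0# < z → x / z * z ≈ x
  /-cancel {x} {z} 0<z = trans (*-assoc _ _ _)
    (trans (*-congˡ (trans (*-comm _ _) (x*x⁻¹≈1 0<z))) (*-identityʳ x))

  /-pos : ∀ {x z} → 0# < x → 0# < z → 0# < x / z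
  /-pos 0<x 0<z = *-pos 0<x (⁻¹-pos 0<z)

  /-unique : ∀ {x y z} → 0# < z → x ≈ y * z → x / z ≈ y
  /-unique {x} {y} {z} 0<z x≈yz = trans (*-congʳ x≈yz)
    (trans (*-assoc _ _ _) (trans (*-congˡ (x*x⁻¹≈1 0<z)) (*-identityʳ y)))

  /-≤ : ∀ {x y z} → 0# < z → x ≤ y * z → x / z ≤ y
  /-≤ 0<z x≤yz = ≤-trans (*-monoʳ-≤ (inj₁ (⁻¹-pos 0<z)) x≤yz) (inj₂ (/-unique 0<z refl))

  ∣∣-nonNeg : ∀ x → 0# ≤ ∣ x ∣
  ∣∣-nonNeg x with x <? 0#
  ... | yes x<0 = ≤-resp-≈ refl (+-identityˡ _) (x≤y⇒0≤y-x (inj₁ x<0))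
  ... | no  x≮0 = ≮⇒≥ x≮0

  ∣∣-square : ∀ x → ∣ x ∣ * ∣ x ∣ ≈ x * x
  ∣∣-square x with x <? 0#
  ... | yes _ = solve 1 (λ x → :- x :* :- x := x :* x) refl x
  ... | no  _ = refl

  square-mono⁻¹ : ∀ {x y} → 0# ≤ y → x * x ≤ y * y → x ≤ y
  square-mono⁻¹ {x} {y} 0≤y xx≤yy with y <? x
  ... | no  y≮x = ≮⇒≥ y≮x
  ... | yes y<x = contradiction xx≤yy (<⇒≱ (<-by ((x - y) * (x + y))
          (*-pos (x<y⇒0<y-x y<x) (+-pos-nonNeg (≤-<-trans 0≤y y<x) 0≤y))
          (solve 2 (λ x y → y :* y :+ (x :- y) :* (x :+ y) := x :* x) refl x y)))

  -- Monotonicity gives `2^ x < 2^ (x + 1#)`, and the right side is twice the left, so the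
  -- difference is `2^ x` itself.
  2^-pos : ∀ x → 0# < 2^ x
  2^-pos x = <-respʳ-≈
    (solve 1 (λ t → t :* con (+ 2) :- t := t) refl (2^ x))
    (x<y⇒0<y-x (<-respʳ-≈ (trans (2^-homo-+ x 1#) (*-congˡ (trans 2^1 (+-congˡ (sym (+-identityʳ 1#))))))
      (2^-mono-< (<-by 1# 0<1 refl))))

  2^-injective : ∀ {x y} → 2^ x ≈ 2^ y → x ≈ y
  2^-injective {x} {y} eq with compare x y
  ... | tri< x<y _ _ = contradiction (2^-mono-< x<y) (irrefl eq)
  ... | tri≈ _ x≈y _ = x≈y
  ... | tri> _ _ y<x = contradiction (2^-mono-< y<x) (irrefl (sym eq))

  2^-ι : ∀ n → 2^ ι n ≈ ι (2 ℕ.^ n)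
  2^-ι zero    = trans (2^-injective₀) (sym (+-identityʳ 1#))
    where
    2^-injective₀ : 2^ 0# ≈ 1#
    2^-injective₀ = ≤-antisym (*-cancelˡ-≤ (2^-pos 0#) (inj₂ eq)) (*-cancelˡ-≤ (2^-pos 0#) (inj₂ (sym eq)))
      where
      eq : 2^ 0# * 2^ 0# ≈ 2^ 0# * 1#
      eq = trans (sym (2^-homo-+ 0# 0#)) (trans (2^-cong (+-identityʳ 0#)) (sym (*-identityʳ _)))
  2^-ι (suc n) = trans (2^-homo-+ 1# (ι n))
    (trans (*-cong (trans 2^1 (+-congˡ (sym (+-identityʳ 1#)))) (2^-ι n)) (sym (ι-* 2 (2 ℕ.^ n))))

  log₂-2^ : ∀ x → log₂ (2^ x) ≈ x
  log₂-2^ x = 2^-injective (2^log₂ (2^-pos x))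

  log₂-* : ∀ {x y} → 0# < x → 0# < y → log₂ (x * y) ≈ log₂ x + log₂ y
  log₂-* 0<x 0<y = 2^-injective (trans (2^log₂ (*-pos 0<x 0<y))
    (trans (*-cong (sym (2^log₂ 0<x)) (sym (2^log₂ 0<y))) (sym (2^-homo-+ _ _))))

  log₂-mono-≤ : ∀ {x y} → 0# < x → x ≤ y → log₂ x ≤ log₂ y
  log₂-mono-≤ 0<x x≤y = ≮⇒≥ λ log-y<log-x →
    <⇒≱ (<-respʳ-≈ (2^log₂ 0<x) (<-respˡ-≈ (2^log₂ (<-≤-trans 0<x x≤y)) (2^-mono-< log-y<log-x))) x≤y

  log₂-ι : ∀ n → log₂ (ι (2 ℕ.^ n)) ≈ ι n
  log₂-ι n = trans (log₂-cong (sym (2^-ι n))) (log₂-2^ (ι n))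

-- Finite sums and indicators.

module FiniteSums (ℝ : RealNumbers) where

  open RealNumbers ℝ
  open MarginalInformation ℝ
  open OrderedField ℝ

  private
    variable
      A B C : Set

  ∑-cong : ∀ (xs : List A) {g h : A → Carrier} → (∀ x → g x ≈ h x) → ∑ xs g ≈ ∑ xs h
  ∑-cong []       g≈h = refl
  ∑-cong (x ∷ xs) g≈h = +-cong (g≈h x) (∑-cong xs g≈h)

  ∑-mono : ∀ (xs : List A) {g h : A → Carrier} → (∀ x → g x ≤ h x) → ∑ xs g ≤ ∑ xs h
  ∑-mono []       g≤h = ≤-refl
  ∑-mono (x ∷ xs) g≤h = +-mono-≤ (g≤h x) (∑-mono xs g≤h)

  ∑-nonNeg : ∀ (xs : List A) {g : A → Carrier} → (∀ x → 0# ≤ g x) → 0# ≤ ∑ xs g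
  ∑-nonNeg []       0≤g = ≤-refl
  ∑-nonNeg (x ∷ xs) 0≤g = +-nonNeg (0≤g x) (∑-nonNeg xs 0≤g)

  ∑-0 : ∀ (xs : List A) → ∑ xs (λ _ → 0#) ≈ 0#
  ∑-0 []       = refl
  ∑-0 (x ∷ xs) = trans (+-identityˡ _) (∑-0 xs)

  ∑-+ : ∀ (xs : List A) (g h : A → Carrier) → ∑ xs (λ x → g x + h x) ≈ ∑ xs g + ∑ xs h
  ∑-+ []       g h = sym (+-identityˡ 0#)
  ∑-+ (x ∷ xs) g h = trans (+-congˡ (∑-+ xs g h))
    (solve 4 (λ a b c d → a :+ b :+ (c :+ d) := a :+ c :+ (b :+ d)) refl _ _ _ _)

  ∑-*ˡ : ∀ (xs : List A) c (g : A → Carrier) → ∑ xs (λ x → c * g x) ≈ c * ∑ xs g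
  ∑-*ˡ []       c g = sym (zeroʳ c)
  ∑-*ˡ (x ∷ xs) c g = trans (+-congˡ (∑-*ˡ xs c g)) (sym (distribˡ _ _ _))

  ∑-*ʳ : ∀ (xs : List A) (g : A → Carrier) c → ∑ xs (λ x → g x * c) ≈ ∑ xs g * c
  ∑-*ʳ xs g c = trans (∑-cong xs λ x → *-comm _ _) (trans (∑-*ˡ xs c g) (*-comm _ _))

  ∑-swap : ∀ (xs : List A) (ys : List B) (g : A → B → Carrier) →
           ∑ xs (λ x → ∑ ys (g x)) ≈ ∑ ys (λ y → ∑ xs λ x → g x y)
  ∑-swap []       ys g = sym (∑-0 ys)
  ∑-swap (x ∷ xs) ys g = trans (+-congˡ (∑-swap xs ys g)) (sym (∑-+ ys (g x) _))

  ∑-++ : ∀ (xs ys : List A) (g : A → Carrier) → ∑ (xs ++ ys) g ≈ ∑ xs g + ∑ ys g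
  ∑-++ []       ys g = sym (+-identityˡ _)
  ∑-++ (x ∷ xs) ys g = trans (+-congˡ (∑-++ xs ys g)) (sym (+-assoc _ _ _))

  ∑-map : ∀ (h : A → B) (xs : List A) (g : B → Carrier) → ∑ (map h xs) g ≈ ∑ xs (λ x → g (h x))
  ∑-map h []       g = refl
  ∑-map h (x ∷ xs) g = +-congˡ (∑-map h xs g)

  ∑-cartesianProductWith : ∀ (h : A → B → C) xs ys (g : C → Carrier) →
    ∑ (cartesianProductWith h xs ys) g ≈ ∑ xs (λ x → ∑ ys λ y → g (h x y))
  ∑-cartesianProductWith h []       ys g = refl
  ∑-cartesianProductWith h (x ∷ xs) ys g = trans (∑-++ (map (h x) ys) _ g)
    (+-cong (∑-map (h x) ys g) (∑-cartesianProductWith h xs ys g))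

  term≤∑ : ∀ {xs : List A} {g : A → Carrier} {x} → (∀ x → 0# ≤ g x) → x ∈ xs → g x ≤ ∑ xs g
  term≤∑ {xs = _ ∷ xs} 0≤g (here ≡.refl) =
    ≤-resp-≈ (+-identityʳ _) refl (+-monoʳ-≤ _ (∑-nonNeg xs 0≤g))
  term≤∑ {xs = _ ∷ xs} 0≤g (there x∈xs)  =
    ≤-resp-≈ (+-identityˡ _) refl (+-mono-≤ (0≤g _) (term≤∑ 0≤g x∈xs))

  ∑-pos : ∀ (xs : List A) {g : A → Carrier} → 0# < ∑ xs g → ∃[ x ] 0# < g x
  ∑-pos []       0<0 = contradiction 0<0 (irrefl refl)
  ∑-pos (x ∷ xs) {g} 0<∑ with 0# <? g x
  ... | yes 0<gx = x , 0<gx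
  ... | no  0≮gx = ∑-pos xs (<-≤-trans 0<∑
    (≤-resp-≈ refl (+-identityˡ _) (+-mono-≤ (≮⇒≥ 0≮gx) ≤-refl)))

  𝟙 : Bool → Carrier
  𝟙 b = if b then 1# else 0#

  𝟙-nonNeg : ∀ b → 0# ≤ 𝟙 b
  𝟙-nonNeg true  = inj₁ 0<1
  𝟙-nonNeg false = ≤-refl

  𝟙≤1 : ∀ b → 𝟙 b ≤ 1#
  𝟙≤1 true  = ≤-refl
  𝟙≤1 false = inj₁ 0<1

  𝟙-∧ : ∀ b c → 𝟙 (b ∧ c) ≈ 𝟙 b * 𝟙 c
  𝟙-∧ true  c = sym (*-identityˡ _)
  𝟙-∧ false c = sym (zeroˡ _)

  if-𝟙 : ∀ b x → (if b then x else 0#) ≈ 𝟙 b * x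
  if-𝟙 true  x = sym (*-identityˡ _)
  if-𝟙 false x = sym (zeroˡ _)

  -- Used in two directions: for an event that holds at one outcome only, and for a family of events
  -- of which exactly one holds at a given outcome.
  Isolates : (A → Bool) → A → Set
  Isolates E v = E v ≡ true × (∀ w → E w ≡ true → v ≡ w)

  ∑-isolate : ∀ {xs : List A} {E v} → Isolates E v → Unique xs → v ∈ xs →
              ∀ (g : A → Carrier) → ∑ xs (λ w → 𝟙 (E w) * g w) ≈ g v
  ∑-isolate {A = A} {E = E} {v} (Ev , unique) u v∈xs g = go u v∈xs
    where
    vanish : ∀ {w} → v ≢ w → 𝟙 (E w) * g w ≈ 0#
    vanish {w} v≢w with E w in Ew
    ... | true  = contradiction (unique w Ew) v≢w
    ... | false = zeroˡ _
    rest : ∀ {ys : List A} → All (v ≢_) ys → ∑ ys (λ w → 𝟙 (E w) * g w) ≈ 0#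
    rest []         = refl
    rest (v≢w ∷ ws) = trans (+-cong (vanish v≢w) (rest ws)) (+-identityʳ 0#)
    go : ∀ {ys} → Unique ys → v ∈ ys → ∑ ys (λ w → 𝟙 (E w) * g w) ≈ g v
    go (v∉ys ∷ _) (here ≡.refl) =
      trans (+-cong (trans (*-congʳ (reflexive (≡.cong 𝟙 Ev))) (*-identityˡ _)) (rest v∉ys)) (+-identityʳ _)
    go (w∉ys ∷ u) (there v∈ys)  =
      trans (+-cong (vanish (λ v≡w → All.lookup w∉ys v∈ys (≡.sym v≡w))) (go u v∈ys)) (+-identityˡ _)

-- Extremal rectangles of a nonnegative matrix.

module Rectangles (ℝ : RealNumbers) where

  open RealNumbers ℝ
  open MarginalInformation ℝ
  open OrderedField ℝ
  open FiniteSums ℝ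

  -- Recursion on the value at `zero`. Subsets are functions, so `Φ` has to respect pointwise
  -- equality.
  argmax : ∀ n (Φ : (Fin n → Bool) → Carrier) → (∀ {S S′} → S ≗ S′ → Φ S ≈ Φ S′) →
           ∃[ S ] ∀ S′ → Φ S′ ≤ Φ S
  argmax zero    Φ Φ-cong = (λ ()) , λ S′ → inj₂ (Φ-cong λ ())
  argmax (suc n) Φ Φ-cong = choose (best true) (best false)
    where
    Best : Bool → Set
    Best b = ∃[ S ] ∀ S′ → Φ (b ∷ᶠ S′) ≤ Φ (b ∷ᶠ S)
    best : ∀ b → Best b
    best b = argmax n (λ S → Φ (b ∷ᶠ S)) λ S≗S′ → Φ-cong λ { zero → ≡.refl ; (suc i) → S≗S′ i }
    split : ∀ S → Φ S ≈ Φ (S zero ∷ᶠ λ i → S (suc i))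
    split S = Φ-cong λ { zero → ≡.refl ; (suc i) → ≡.refl }
    dominated : ∀ {S} → (∀ b S′ → Φ (b ∷ᶠ S′) ≤ Φ S) → ∃[ S ] ∀ S′ → Φ S′ ≤ Φ S
    dominated {S} max = S , λ S′ → ≤-trans (inj₂ (split S′)) (max _ _)
    choose : Best true → Best false → ∃[ S ] ∀ S′ → Φ S′ ≤ Φ S
    choose (S , maxS) (T , maxT) with Φ (true ∷ᶠ S) ≤? Φ (false ∷ᶠ T)
    ... | yes S≤T = dominated λ { true S′ → ≤-trans (maxS S′) S≤T ; false S′ → maxT S′ }
    ... | no  S≰T = dominated λ { true S′ → maxS S′
                                ; false S′ → ≤-trans (maxT S′) (≮⇒≥ λ S<T → S≰T (inj₁ S<T)) }

  argmax₂ : ∀ a b (Φ : (Fin a → Bool) → (Fin b → Bool) → Carrier) →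
            (∀ {S S′ T T′} → S ≗ S′ → T ≗ T′ → Φ S T ≈ Φ S′ T′) →
            ∃₂ λ S T → ∀ S′ T′ → Φ S′ T′ ≤ Φ S T
  argmax₂ a b Φ Φ-cong = S , proj₁ (inner S) , λ S′ T′ → ≤-trans (proj₂ (inner S′) T′) (maxS S′)
    where
    inner : ∀ S → ∃[ T ] ∀ T′ → Φ S T′ ≤ Φ S T
    inner S = argmax b (Φ S) (Φ-cong λ _ → ≡.refl)
    value : (Fin a → Bool) → Carrier
    value S = Φ S (proj₁ (inner S))
    -- The maximiser found for `S` may differ from the one found for a pointwise equal `S′`, but the
    -- two maximal values bound each other; this makes `argmax` applicable to `value`.
    value-mono : ∀ {S S′} → S ≗ S′ → value S ≤ value S′
    value-mono {S} {S′} eq = ≤-trans (inj₂ (Φ-cong eq λ _ → ≡.refl)) (proj₂ (inner S′) _)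
    outer : ∃[ S ] ∀ S′ → value S′ ≤ value S
    outer = argmax a value λ eq → ≤-antisym (value-mono eq) (value-mono λ i → ≡.sym (eq i))
    S = proj₁ outer
    maxS = proj₂ outer

  fin-isolates : ∀ {n} (i : Fin n) → Isolates (λ j → does (i Fin.≟ j)) i
  fin-isolates i = true! , unique
    where
    true! : does (i Fin.≟ i) ≡ true
    true! with i Fin.≟ i
    ... | yes _   = ≡.refl
    ... | no  i≢i = contradiction ≡.refl i≢i
    unique : ∀ j → does (i Fin.≟ j) ≡ true → i ≡ j
    unique j eq with i Fin.≟ j
    ... | yes i≡j = i≡j

  ∑-fin-isolate : ∀ {n} (i : Fin n) (g : Fin n → Carrier) →
                  ∑ (allFin n) (λ j → 𝟙 (does (i Fin.≟ j)) * g j) ≈ g i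
  ∑-fin-isolate {n} i = ∑-isolate (fin-isolates i) (Unique.allFin⁺ n) (∈-allFin i)

  𝟙-cong : ∀ {b c} → b ≡ c → 𝟙 b ≈ 𝟙 c
  𝟙-cong b≡c = reflexive (≡.cong 𝟙 b≡c)

  _∖_ : ∀ {n} → (Fin n → Bool) → Fin n → Fin n → Bool
  (S ∖ i) j = S j ∧ not (does (i Fin.≟ j))

  𝟙-∖ : ∀ {n} {S : Fin n → Bool} {i} → S i ≡ true → ∀ j →
        𝟙 (S j) ≈ 𝟙 ((S ∖ i) j) + 𝟙 (does (i Fin.≟ j))
  𝟙-∖ {S = S} {i} Si j with i Fin.≟ j | S j in Sj
  ... | yes ≡.refl | true  = sym (+-identityˡ _)
  ... | yes ≡.refl | false = contradiction (≡.trans (≡.sym Sj) Si) λ ()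
  ... | no  _      | true  = sym (+-identityʳ _)
  ... | no  _      | false = sym (+-identityʳ _)

  𝟙-split : ∀ b c → 𝟙 b ≈ 𝟙 (b ∧ c) + 𝟙 (b ∧ not c)
  𝟙-split true  true  = sym (+-identityʳ _)
  𝟙-split true  false = sym (+-identityˡ _)
  𝟙-split false _     = sym (+-identityʳ _)

  module _ {a b : ℕ} where

    Matrix : Set
    Matrix = Fin a → Fin b → Carrier

    infix 8 ⟪_∣_,_⟫
    opaque
      ⟪_∣_,_⟫ : Matrix → (Fin a → Carrier) → (Fin b → Carrier) → Carrier
      ⟪ w ∣ u , v ⟫ = ∑ (allFin a) λ x → ∑ (allFin b) λ y → w x y * (u x * v y)

      ⟪⟫-∑ : ∀ {w : Matrix} {u v} →
             ⟪ w ∣ u , v ⟫ ≈ ∑ (allFin a) (λ x → ∑ (allFin b) λ y → w x y * (u x * v y))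
      ⟪⟫-∑ = refl

      ⟪⟫-cong : ∀ {w w′ : Matrix} {u u′ v v′} →
                (∀ x y → w x y * (u x * v y) ≈ w′ x y * (u′ x * v′ y)) →
                ⟪ w ∣ u , v ⟫ ≈ ⟪ w′ ∣ u′ , v′ ⟫
      ⟪⟫-cong eq = ∑-cong (allFin a) λ x → ∑-cong (allFin b) λ y → eq x y

      ⟪⟫-mono : ∀ {w w′ : Matrix} {u u′ v v′} →
                (∀ x y → w x y * (u x * v y) ≤ w′ x y * (u′ x * v′ y)) →
                ⟪ w ∣ u , v ⟫ ≤ ⟪ w′ ∣ u′ , v′ ⟫
      ⟪⟫-mono le = ∑-mono (allFin a) λ x → ∑-mono (allFin b) λ y → le x y

      ⟪⟫-nonNeg : ∀ {w : Matrix} {u v} → (∀ x y → 0# ≤ w x y) → (∀ x → 0# ≤ u x) → (∀ y → 0# ≤ v y) →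
                  0# ≤ ⟪ w ∣ u , v ⟫
      ⟪⟫-nonNeg 0≤w 0≤u 0≤v = ∑-nonNeg (allFin a) λ x → ∑-nonNeg (allFin b) λ y →
        *-nonNeg (0≤w x y) (*-nonNeg (0≤u x) (0≤v y))

      ⟪⟫-+ : ∀ {w w₁ w₂ : Matrix} {u u₁ u₂ v v₁ v₂} →
             (∀ x y → w x y * (u x * v y) ≈ w₁ x y * (u₁ x * v₁ y) + w₂ x y * (u₂ x * v₂ y)) →
             ⟪ w ∣ u , v ⟫ ≈ ⟪ w₁ ∣ u₁ , v₁ ⟫ + ⟪ w₂ ∣ u₂ , v₂ ⟫
      ⟪⟫-+ eq = trans
        (∑-cong (allFin a) λ x → trans (∑-cong (allFin b) λ y → eq x y) (∑-+ (allFin b) _ _))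
        (∑-+ (allFin a) _ _)

      ⟪⟫-+ˡ : ∀ {w : Matrix} {u u₁ u₂ v} → (∀ x → u x ≈ u₁ x + u₂ x) →
              ⟪ w ∣ u , v ⟫ ≈ ⟪ w ∣ u₁ , v ⟫ + ⟪ w ∣ u₂ , v ⟫
      ⟪⟫-+ˡ {w} {u} {u₁} {u₂} {v} eq = ⟪⟫-+ λ x y → trans (*-congˡ (*-congʳ (eq x)))
        (solve 4 (λ w u u′ v → w :* ((u :+ u′) :* v) := w :* (u :* v) :+ w :* (u′ :* v)) refl _ _ _ _)

      ⟪⟫-+ʳ : ∀ {w : Matrix} {u v v₁ v₂} → (∀ y → v y ≈ v₁ y + v₂ y) →
              ⟪ w ∣ u , v ⟫ ≈ ⟪ w ∣ u , v₁ ⟫ + ⟪ w ∣ u , v₂ ⟫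
      ⟪⟫-+ʳ {w} {u} {v} {v₁} {v₂} eq = ⟪⟫-+ λ x y → trans (*-congˡ (*-congˡ (eq y)))
        (solve 4 (λ w u v v′ → w :* (u :* (v :+ v′)) := w :* (u :* v) :+ w :* (u :* v′)) refl _ _ _ _)

      ⟪⟫-isolate : ∀ {w : Matrix} x {v} →
        ⟪ w ∣ (λ i → 𝟙 (does (x Fin.≟ i))) , v ⟫ ≈ ∑ (allFin b) λ y → w x y * v y
      ⟪⟫-isolate {w} x {v} = trans
        (∑-cong (allFin a) λ i → trans
          (∑-cong (allFin b) λ y →
            solve 3 (λ w u v → w :* (u :* v) := u :* (w :* v)) refl _ _ _)
          (∑-*ˡ (allFin b) _ _))
        (∑-fin-isolate x λ i → ∑ (allFin b) λ y → w i y * v y)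

    ⟪_∣_⨯_⟫ : Matrix → (Fin a → Bool) → (Fin b → Bool) → Carrier
    ⟪ w ∣ S ⨯ T ⟫ = ⟪ w ∣ (λ x → 𝟙 (S x)) , (λ y → 𝟙 (T y)) ⟫

    -- Each row and column is charged `γ` times its prior. A single maximisation then replaces the
    -- iterated deletion of light rows and columns.
    penalised : Matrix → (Fin a → Carrier) → (Fin b → Carrier) → Carrier →
                (Fin a → Bool) → (Fin b → Bool) → Carrier
    penalised w α β γ S T = ⟪ w ∣ S ⨯ T ⟫ -
      γ * (∑ (allFin a) (λ x → 𝟙 (S x) * α x) + ∑ (allFin b) (λ y → 𝟙 (T y) * β y))

    -- Dropping row `x` from a maximiser loses its mass and saves its charge `γ * α x`, so the mass
    -- is at least the charge.
    penalised-row : ∀ {w α β γ S T} → (∀ S′ → penalised w α β γ S′ T ≤ penalised w α β γ S T) →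
                    ∀ x → S x ≡ true → γ * α x ≤ ∑ (allFin b) λ y → w x y * 𝟙 (T y)
    penalised-row {w} {α} {β} {γ} {S} {T} max x Sx =
      ≤-by _ (x≤y⇒0≤y-x (≤-trans (max (S ∖ x)) (inj₂ (+-cong mass-split
          (-‿cong (*-congˡ (+-congʳ α-split)))))))
        (solve 6 (λ M r γ A α B → γ :* α :+ ((M :+ r) :- γ :* ((A :+ α) :+ B) :- (M :- γ :* (A :+ B))) := r)
          refl _ _ γ _ (α x) _)
      where
      mass-split : ⟪ w ∣ S ⨯ T ⟫ ≈ ⟪ w ∣ S ∖ x ⨯ T ⟫ + ∑ (allFin b) λ y → w x y * 𝟙 (T y)
      mass-split = trans (⟪⟫-+ˡ {w = w} (𝟙-∖ {S = S} {x} Sx)) (+-congˡ (⟪⟫-isolate x))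
      α-split : ∑ (allFin a) (λ i → 𝟙 (S i) * α i) ≈ ∑ (allFin a) (λ i → 𝟙 ((S ∖ x) i) * α i) + α x
      α-split = trans (∑-cong (allFin a) λ i → trans (*-congʳ (𝟙-∖ {S = S} {x} Sx i)) (distribʳ _ _ _))
        (trans (∑-+ (allFin a) _ _) (+-congˡ (∑-fin-isolate x α)))

  opaque
   unfolding ⟪_∣_,_⟫
   ⟪⟫-transpose : ∀ {a b} (w : Matrix {a} {b}) u v → ⟪ w ∣ u , v ⟫ ≈ ⟪ (λ y x → w x y) ∣ v , u ⟫
   ⟪⟫-transpose {a} {b} w u v = trans (∑-swap (allFin a) (allFin b) _)
      (∑-cong (allFin b) λ y → ∑-cong (allFin a) λ x → *-congˡ (*-comm _ _))

  penalised-transpose : ∀ {a b} (w : Matrix {a} {b}) α β γ S T →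
    penalised w α β γ S T ≈ penalised (λ y x → w x y) β α γ T S
  penalised-transpose {a} {b} w α β γ S T = +-cong
    (⟪⟫-transpose w _ _)
    (-‿cong (*-congˡ (+-comm _ _)))

  module _ {a b : ℕ} where

    Row-heavy : Matrix {a} {b} → (Fin a → Carrier) → Carrier → (Fin a → Bool) → (Fin b → Bool) → Set
    Row-heavy w α γ S T = ∀ x → S x ≡ true → γ * α x ≤ ∑ (allFin b) λ y → w x y * 𝟙 (T y)

    Column-heavy : Matrix {a} {b} → (Fin b → Carrier) → Carrier → (Fin a → Bool) → (Fin b → Bool) → Set
    Column-heavy w β γ S T = ∀ y → T y ≡ true → γ * β y ≤ ∑ (allFin a) λ x → w x y * 𝟙 (S x)

    -- A maximiser of `penalised` is heavy in its rows, and by transposition in its columns. It does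
    -- at least as well as the full rectangle, whose charge is `γ * ι 2` because both priors have
    -- total 1, so it has lost at most that much mass.
    heavy-rectangle : ∀ {w α β γ} → (∀ x y → 0# ≤ w x y) → 0# ≤ γ →
      (∀ x → 0# ≤ α x) → ∑ (allFin a) α ≈ 1# → (∀ y → 0# ≤ β y) → ∑ (allFin b) β ≈ 1# →
      ∃₂ λ S T → Row-heavy w α γ S T × Column-heavy w β γ S T ×
        ⟪ w ∣ (λ _ → 1#) , (λ _ → 1#) ⟫ ≤ ⟪ w ∣ S ⨯ T ⟫ + γ * ι 2
    heavy-rectangle {w} {α} {β} {γ} 0≤w 0≤γ 0≤α ∑α 0≤β ∑β = conclude
      (argmax₂ a b (penalised w α β γ) λ S≗S′ T≗T′ → +-cong
        (⟪⟫-cong λ x y → *-congˡ (*-cong (𝟙-cong (S≗S′ x)) (𝟙-cong (T≗T′ y))))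
        (-‿cong (*-congˡ (+-cong (∑-cong (allFin a) λ x → *-congʳ (𝟙-cong (S≗S′ x)))
                                 (∑-cong (allFin b) λ y → *-congʳ (𝟙-cong (T≗T′ y)))))))
      where
      penalty : (Fin a → Bool) → (Fin b → Bool) → Carrier
      penalty S T = ∑ (allFin a) (λ x → 𝟙 (S x) * α x) + ∑ (allFin b) (λ y → 𝟙 (T y) * β y)
      0≤penalty : ∀ S T → 0# ≤ penalty S T
      0≤penalty S T = +-nonNeg
        (∑-nonNeg (allFin a) λ x → *-nonNeg (𝟙-nonNeg (S x)) (0≤α x))
        (∑-nonNeg (allFin b) λ y → *-nonNeg (𝟙-nonNeg (T y)) (0≤β y))
      full-penalty : penalty (λ _ → true) (λ _ → true) ≈ ι 2
      full-penalty = +-cong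
        (trans (∑-cong (allFin a) λ _ → *-identityˡ _) ∑α)
        (trans (∑-cong (allFin b) λ _ → *-identityˡ _) (trans ∑β (sym (+-identityʳ 1#))))
      cancel-penalty : ∀ {F M f P} → F - γ * f ≤ M - γ * P → f ≈ ι 2 → 0# ≤ P → F ≤ M + γ * ι 2
      cancel-penalty {F} {M} {f} {P} le f≈2 0≤P = ≤-trans
        (≤-by _ (+-nonNeg (x≤y⇒0≤y-x le) (*-nonNeg 0≤γ 0≤P))
          (solve 5 (λ F M γ f P → F :+ (M :- γ :* P :- (F :- γ :* f) :+ γ :* P) := M :+ γ :* f) refl F M γ f P))
        (inj₂ (+-congˡ (*-congˡ f≈2)))
      conclude : (∃₂ λ S T → ∀ S′ T′ → penalised w α β γ S′ T′ ≤ penalised w α β γ S T) →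
        ∃₂ λ S T → Row-heavy w α γ S T × Column-heavy w β γ S T ×
          ⟪ w ∣ (λ _ → 1#) , (λ _ → 1#) ⟫ ≤ ⟪ w ∣ S ⨯ T ⟫ + γ * ι 2
      conclude (S , T , max) = S , T
        , penalised-row {w = w} {α} {β} {γ} {S} {T} (λ S′ → max S′ T)
        , penalised-row {w = λ y x → w x y} {β} {α} {γ} {T} {S} (λ T′ → ≤-resp-≈ (penalised-transpose w α β γ S T′)
                                         (penalised-transpose w α β γ S T) (max S T′))
        , cancel-penalty (max (λ _ → true) (λ _ → true)) full-penalty (0≤penalty S T)

  module _ {a b : ℕ} where

    ⨯-cong : ∀ {w : Matrix {a} {b}} {S S′ T T′} → S ≗ S′ → T ≗ T′ → ⟪ w ∣ S ⨯ T ⟫ ≈ ⟪ w ∣ S′ ⨯ T′ ⟫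
    ⨯-cong S≗S′ T≗T′ = ⟪⟫-cong λ x y → *-congˡ (*-cong (𝟙-cong (S≗S′ x)) (𝟙-cong (T≗T′ y)))

    ⨯-nonNeg : ∀ {w : Matrix {a} {b}} → (∀ x y → 0# ≤ w x y) → ∀ S T → 0# ≤ ⟪ w ∣ S ⨯ T ⟫
    ⨯-nonNeg 0≤w S T = ⟪⟫-nonNeg 0≤w (λ x → 𝟙-nonNeg (S x)) (λ y → 𝟙-nonNeg (T y))

    -- Entrywise domination bounds both the signed mass and its negative; squares avoid
    -- distinguishing its sign.
    ⨯-∣∣-≤ : ∀ {w e : Matrix {a} {b}} → (∀ x y → e x y ≤ w x y) → (∀ x y → - e x y ≤ w x y) →
             ∀ S T → ⟪ e ∣ S ⨯ T ⟫ * ⟪ e ∣ S ⨯ T ⟫ ≤ ⟪ w ∣ S ⨯ T ⟫ * ⟪ w ∣ S ⨯ T ⟫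
    ⨯-∣∣-≤ {w} {e} e≤w -e≤w S T = square-≤ upper lower
      where
      square-≤ : ∀ {x y} → x ≤ y → 0# ≤ x + y → x * x ≤ y * y
      square-≤ {x} {y} x≤y 0≤x+y = ≤-by _ (*-nonNeg (x≤y⇒0≤y-x x≤y) 0≤x+y)
        (solve 2 (λ x y → x :* x :+ (y :- x) :* (x :+ y) := y :* y) refl x y)
      0≤u : ∀ x y → 0# ≤ 𝟙 (S x) * 𝟙 (T y)
      0≤u x y = *-nonNeg (𝟙-nonNeg (S x)) (𝟙-nonNeg (T y))
      upper : ⟪ e ∣ S ⨯ T ⟫ ≤ ⟪ w ∣ S ⨯ T ⟫
      upper = ⟪⟫-mono λ x y → *-monoʳ-≤ (0≤u x y) (e≤w x y)
      lower : 0# ≤ ⟪ e ∣ S ⨯ T ⟫ + ⟪ w ∣ S ⨯ T ⟫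
      lower = ≤-resp-≈ refl
        (⟪⟫-+ {w = λ x y → e x y + w x y} λ x y → distribʳ _ _ _)
        (⟪⟫-nonNeg (λ x y → ≤-resp-≈ refl (trans (+-congˡ (-‿involutive _)) (+-comm _ _)) (x≤y⇒0≤y-x (-e≤w x y)))
          (λ x → 𝟙-nonNeg (S x)) (λ y → 𝟙-nonNeg (T y)))

    -- `V` is the maximum of E²/μ. Clearing the denominator lets the last clause cover rectangles of
    -- mass 0 as well.
    Densest : (w e : Matrix {a} {b}) (S₀ : Fin a → Bool) (T₀ : Fin b → Bool) (V : Carrier) → Set
    Densest w e S₀ T₀ V = 0# < V × 0# < ⟪ w ∣ S₀ ⨯ T₀ ⟫ ×
      ⟪ e ∣ S₀ ⨯ T₀ ⟫ * ⟪ e ∣ S₀ ⨯ T₀ ⟫ ≈ V * ⟪ w ∣ S₀ ⨯ T₀ ⟫ ×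
      (∀ S T → ⟪ e ∣ S ⨯ T ⟫ * ⟪ e ∣ S ⨯ T ⟫ ≤ V * ⟪ w ∣ S ⨯ T ⟫)

    densest-rectangle : ∀ {w e : Matrix {a} {b}} →
      (∀ x y → 0# ≤ w x y) → (∀ x y → e x y ≤ w x y) → (∀ x y → - e x y ≤ w x y) →
      let H = ⟪ e ∣ (λ _ → 1#) , (λ _ → 1#) ⟫ in 0# < H * H →
      ∃₂ λ S₀ T₀ → ∃[ V ] Densest w e S₀ T₀ V
    densest-rectangle {w} {e} 0≤w e≤w -e≤w 0<HH = conclude
      (argmax₂ a b Φ λ S≗S′ T≗T′ →
        *-cong (*-cong (⨯-cong S≗S′ T≗T′) (⨯-cong S≗S′ T≗T′)) (⁻¹-cong (⨯-cong S≗S′ T≗T′)))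
      where
      weight signed Φ : (Fin a → Bool) → (Fin b → Bool) → Carrier
      weight S T = ⟪ w ∣ S ⨯ T ⟫
      signed S T = ⟪ e ∣ S ⨯ T ⟫
      Φ S T = signed S T * signed S T / weight S T
      conclude : (∃₂ λ S₀ T₀ → ∀ S T → Φ S T ≤ Φ S₀ T₀) → ∃₂ λ S₀ T₀ → ∃[ V ] Densest w e S₀ T₀ V
      conclude (S₀ , T₀ , max) = S₀ , T₀ , V , 0<V , 0<μ₀ , sym (/-cancel 0<μ₀) , signed²≤
        where
        V = Φ S₀ T₀
        signed²≤ : ∀ S T → signed S T * signed S T ≤ V * weight S T
        signed²≤ S T with 0# <? weight S T
        ... | yes 0<m = ≤-trans (inj₂ (sym (/-cancel 0<m))) (*-monoʳ-≤ (inj₁ 0<m) (max S T))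
        -- Division by a mass 0 cannot be undone, but then the signed mass is 0 too.
        ... | no  0≮m = ≤-trans (⨯-∣∣-≤ e≤w -e≤w S T)
          (inj₂ (trans (*-congʳ m≈0) (trans (zeroˡ _) (sym (trans (*-congˡ m≈0) (zeroʳ _))))))
          where m≈0 = ≤-antisym (≮⇒≥ 0≮m) (⨯-nonNeg 0≤w S T)
        0<V : 0# < V
        0<V = *-cancelʳ-pos (⨯-nonNeg 0≤w (λ _ → true) (λ _ → true))
          (<-≤-trans 0<HH (signed²≤ (λ _ → true) (λ _ → true)))
        0<μ₀ : 0# < weight S₀ T₀
        0<μ₀ with 0# <? weight S₀ T₀
        ... | yes 0<μ₀ = 0<μ₀
        ... | no  0≮μ₀ = contradiction V≤0 (<⇒≱ 0<V)
          where
          E₀²≤0 : signed S₀ T₀ * signed S₀ T₀ ≤ 0#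
          E₀²≤0 = ≤-trans (signed²≤ S₀ T₀)
            (≤-trans (*-monoˡ-≤ (inj₁ 0<V) (≮⇒≥ 0≮μ₀)) (inj₂ (zeroʳ V)))
          -- The numerator of `V` would vanish, so `V` would be 0 whatever the value of `0# ⁻¹`.
          V≤0 : V ≤ 0#
          V≤0 = inj₂ (trans (*-congʳ (≤-antisym E₀²≤0 (square-nonNeg _))) (zeroˡ _))

    -- (x + y + z)² ≤ 2x² + 4y² + 4z²
    square-of-remainder : ∀ {s x y z} → s ≈ x + y + z → ι 16 * (y * y) ≤ s * s → ι 16 * (z * z) ≤ s * s →
                          s * s ≤ ι 4 * (x * x)
    square-of-remainder {s} {x} {y} {z} s≈ small₁ small₂ = ≤-trans (inj₂ ss≈) (*-cancelˡ-≤ (ι-pos 1) (≤-by _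
        (+-nonNeg (+-nonNeg (x≤y⇒0≤y-x (≤-resp-≈ refl ss≈ small₁)) (x≤y⇒0≤y-x (≤-resp-≈ refl ss≈ small₂)))
          (*-nonNeg (ι-nonNeg 4) (+-nonNeg (square-nonNeg (x - (y + z)))
            (*-nonNeg (ι-nonNeg 2) (square-nonNeg (y - z))))))
        (solve 3 (λ x y z → let X = (x :+ y :+ z) :* (x :+ y :+ z) in
            con (+ 2) :* X :+ (X :- con (+ 16) :* (y :* y) :+ (X :- con (+ 16) :* (z :* z)) :+
              con (+ 4) :* ((x :- (y :+ z)) :* (x :- (y :+ z)) :+ con (+ 2) :* ((y :- z) :* (y :- z)))) :=
            con (+ 2) :* (con (+ 4) :* (x :* x))) refl x y z)))
      where
      ss≈ : s * s ≈ (x + y + z) * (x + y + z)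
      ss≈ = *-cong s≈ s≈

    module _ {w e : Matrix {a} {b}} {S₀ T₀ V} (0≤w : ∀ x y → 0# ≤ w x y) (densest : Densest w e S₀ T₀ V) where

      private
        μ₀ = ⟪ w ∣ S₀ ⨯ T₀ ⟫
        E₀ = ⟪ e ∣ S₀ ⨯ T₀ ⟫
        γ = μ₀ / ι 32
        w₀ : Matrix
        w₀ x y = w x y * (𝟙 (S₀ x) * 𝟙 (T₀ y))
        0<V = proj₁ densest
        0<μ₀ = proj₁ (proj₂ densest)
        E₀²≈Vμ₀ = proj₁ (proj₂ (proj₂ densest))
        signed²≤ = proj₂ (proj₂ (proj₂ densest))

      -- The heavy rectangle was found for `w₀`, which vanishes outside the densest rectangle. It
      -- may stick out of the latter and is therefore intersected with it.
      heavy-subrectangle : ∀ {α β} → (∀ x → 0# ≤ α x) → (∀ y → 0# ≤ β y) → ∀ S₁ T₁ →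
        Row-heavy w₀ α γ S₁ T₁ → Column-heavy w₀ β γ S₁ T₁ →
        ⟪ w₀ ∣ (λ _ → 1#) , (λ _ → 1#) ⟫ ≤ ⟪ w₀ ∣ S₁ ⨯ T₁ ⟫ + γ * ι 2 →
        ∃₂ λ S T → let μ = ⟪ w ∣ S ⨯ T ⟫ ; E = ⟪ e ∣ S ⨯ T ⟫ in
          0# < μ × V * μ ≤ ι 4 * (E * E) × Row-heavy w α (μ / ι 32) S T × Column-heavy w β (μ / ι 32) S T
      heavy-subrectangle {α} {β} 0≤α 0≤β S₁ T₁ row₁ column₁ lost₁ = S , T , 0<μ , dense , row , column
        where
        S S′ : Fin a → Bool
        S x  = S₀ x ∧ S₁ x
        S′ x = S₀ x ∧ not (S₁ x)
        T T′ : Fin b → Bool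
        T y  = T₀ y ∧ T₁ y
        T′ y = T₀ y ∧ not (T₁ y)
        μ = ⟪ w ∣ S ⨯ T ⟫
        E = ⟪ e ∣ S ⨯ T ⟫
        -- The removed region is cut into the rectangles `S′ ⨯ T` and `S₀ ⨯ T′`, since the
        -- maximality of `V` speaks about rectangles only.
        partition : ∀ (w : Matrix) → ⟪ w ∣ S₀ ⨯ T₀ ⟫ ≈ ⟪ w ∣ S ⨯ T ⟫ + ⟪ w ∣ S′ ⨯ T ⟫ + ⟪ w ∣ S₀ ⨯ T′ ⟫
        partition w = trans (⟪⟫-+ʳ {w = w} λ y → 𝟙-split (T₀ y) (T₁ y))
          (+-congʳ (⟪⟫-+ˡ {w = w} λ x → 𝟙-split (S₀ x) (S₁ x)))
        total-w₀ : ⟪ w₀ ∣ (λ _ → 1#) , (λ _ → 1#) ⟫ ≈ ⟪ w ∣ S₀ ⨯ T₀ ⟫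
        total-w₀ = ⟪⟫-cong λ x y → trans (*-congˡ (*-identityˡ 1#)) (*-identityʳ _)
        ⨯-w₀ : ⟪ w₀ ∣ S₁ ⨯ T₁ ⟫ ≈ μ
        ⨯-w₀ = ⟪⟫-cong {w = w₀} {w′ = w} λ x y → trans
          (solve 5 (λ w s t s′ t′ → w :* (s :* t) :* (s′ :* t′) := w :* (s :* s′ :* (t :* t′)))
            refl (w x y) (𝟙 (S₀ x)) (𝟙 (T₀ y)) (𝟙 (S₁ x)) (𝟙 (T₁ y)))
          (*-congˡ (*-cong (sym (𝟙-∧ (S₀ x) (S₁ x))) (sym (𝟙-∧ (T₀ y) (T₁ y)))))
        0≤S′T = ⨯-nonNeg 0≤w S′ T
        0≤S₀T′ = ⨯-nonNeg 0≤w S₀ T′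
        parts-≤ : ∀ {m m₁ m₂ g} → m + m₁ + m₂ ≤ m + g → 0# ≤ m₁ → 0# ≤ m₂ → m₁ ≤ g × m₂ ≤ g
        parts-≤ {m} {m₁} {m₂} {g} le 0≤m₁ 0≤m₂ =
          ≤-by _ (+-nonNeg 0≤m₂ (x≤y⇒0≤y-x le))
            (solve 4 (λ m m₁ m₂ g → m₁ :+ (m₂ :+ (m :+ g :- (m :+ m₁ :+ m₂))) := g) refl m m₁ m₂ g) ,
          ≤-by _ (+-nonNeg 0≤m₁ (x≤y⇒0≤y-x le))
            (solve 4 (λ m m₁ m₂ g → m₂ :+ (m₁ :+ (m :+ g :- (m :+ m₁ :+ m₂))) := g) refl m m₁ m₂ g)
        lost : ⟪ w ∣ S′ ⨯ T ⟫ ≤ γ * ι 2 × ⟪ w ∣ S₀ ⨯ T′ ⟫ ≤ γ * ι 2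
        lost = parts-≤ (≤-resp-≈ (trans total-w₀ (partition w)) (+-congʳ ⨯-w₀) lost₁) 0≤S′T 0≤S₀T′
        -- This fixes the constant 32 in `γ`: a strip of mass at most `γ * ι 2`, a sixteenth of
        -- `μ₀`, has |E| at most |E₀|/4, so two strips leave at least half of |E₀|.
        sixteenth : ι 16 * (V * (γ * ι 2)) ≈ E₀ * E₀
        sixteenth = trans
          (solve 2 (λ V γ → con (+ 16) :* (V :* (γ :* con (+ 2))) := V :* (γ :* con (+ 32))) refl V γ)
          (trans (*-congˡ (/-cancel (ι-pos 31))) (sym E₀²≈Vμ₀))
        small : ∀ S T → ⟪ w ∣ S ⨯ T ⟫ ≤ γ * ι 2 → ι 16 * (⟪ e ∣ S ⨯ T ⟫ * ⟪ e ∣ S ⨯ T ⟫) ≤ E₀ * E₀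
        small S T m≤2γ = ≤-trans (*-monoˡ-≤ (ι-nonNeg 16)
          (≤-trans (signed²≤ S T) (*-monoˡ-≤ (inj₁ 0<V) m≤2γ))) (inj₂ sixteenth)
        E₀²≤4E² : E₀ * E₀ ≤ ι 4 * (E * E)
        E₀²≤4E² = square-of-remainder (partition e) (small S′ T (proj₁ lost)) (small S₀ T′ (proj₂ lost))
        0<μ : 0# < μ
        0<μ = *-cancelˡ-pos (inj₁ 0<V) (<-≤-trans
          (*-cancelˡ-pos (ι-nonNeg 4) (<-≤-trans (<-respʳ-≈ (sym E₀²≈Vμ₀) (*-pos 0<V 0<μ₀)) E₀²≤4E²))
          (signed²≤ S T))
        μ≤μ₀ : μ ≤ μ₀
        μ≤μ₀ = ≤-by _ (+-nonNeg 0≤S′T 0≤S₀T′) (trans (sym (+-assoc _ _ _)) (sym (partition w)))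
        dense : V * μ ≤ ι 4 * (E * E)
        dense = ≤-trans (*-monoˡ-≤ (inj₁ 0<V) μ≤μ₀) (≤-trans (inj₂ (sym E₀²≈Vμ₀)) E₀²≤4E²)
        γ-weaken : ∀ {t} → 0# ≤ t → μ / ι 32 * t ≤ γ * t
        γ-weaken 0≤t = *-monoʳ-≤ 0≤t (*-monoʳ-≤ (inj₁ (⁻¹-pos (ι-pos 31))) μ≤μ₀)
        ∧-elimʳ : ∀ b c → b ∧ c ≡ true → c ≡ true
        ∧-elimʳ true true _ = ≡.refl
        -- A row or column sum of `w₀` over the heavy rectangle is at most the sum of `w` over the
        -- intersection, so heaviness passes from `w₀` to `w`.
        restrict : ∀ w s t t₁ → 0# ≤ w → w * (𝟙 s * 𝟙 t) * 𝟙 t₁ ≤ w * 𝟙 (t ∧ t₁)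
        restrict w s t t₁ 0≤w = ≤-trans (inj₂ (trans
            (solve 4 (λ w s t t₁ → w :* (s :* t) :* t₁ := s :* (w :* (t :* t₁))) refl w (𝟙 s) (𝟙 t) (𝟙 t₁))
            (*-congˡ (*-congˡ (sym (𝟙-∧ t t₁))))))
          (≤-trans (*-monoʳ-≤ (*-nonNeg 0≤w (𝟙-nonNeg (t ∧ t₁))) (𝟙≤1 s)) (inj₂ (*-identityˡ _)))
        row : Row-heavy w α (μ / ι 32) S T
        row x Sx = ≤-trans (γ-weaken (0≤α x)) (≤-trans (row₁ x (∧-elimʳ (S₀ x) (S₁ x) Sx))
          (∑-mono (allFin b) λ y → restrict (w x y) (S₀ x) (T₀ y) (T₁ y) (0≤w x y)))
        column : Column-heavy w β (μ / ι 32) S T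
        column y Ty = ≤-trans (γ-weaken (0≤β y)) (≤-trans (column₁ y (∧-elimʳ (T₀ y) (T₁ y) Ty))
          (∑-mono (allFin a) λ x → ≤-trans (*-monoʳ-≤ (𝟙-nonNeg (S₁ x)) (inj₂ (*-congˡ (*-comm _ _))))
            (restrict (w x y) (T₀ y) (S₀ x) (S₁ x) (0≤w x y))))

    -- With `H` and `W` the signed and the plain mass of the full rectangle, the second clause is
    -- E²/μ ≥ H²/(4 W) without denominators; the 4 is the price of halving E.
    DenseHeavy : (w e : Matrix {a} {b}) (α : Fin a → Carrier) (β : Fin b → Carrier) (H W : Carrier) →
                 (Fin a → Bool) → (Fin b → Bool) → Set
    DenseHeavy w e α β H W S T = let μ = ⟪ w ∣ S ⨯ T ⟫ ; E = ⟪ e ∣ S ⨯ T ⟫ in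
      0# < μ × H * H * μ ≤ ι 4 * (E * E) * W ×
      Row-heavy w α (μ / ι 32) S T × Column-heavy w β (μ / ι 32) S T

    -- Among all rectangles take one maximising E²/μ.  Every subrectangle of
    -- mass at most μ/16 then carries at most a quarter of E, so passing to a
    -- heavy subrectangle, which discards mass at most μ/16, costs half of E.
    dense-heavy-rectangle : ∀ {w e : Matrix {a} {b}} {α β} →
      (∀ x y → 0# ≤ w x y) → (∀ x y → e x y ≤ w x y) → (∀ x y → - e x y ≤ w x y) →
      (∀ x → 0# ≤ α x) → ∑ (allFin a) α ≈ 1# → (∀ y → 0# ≤ β y) → ∑ (allFin b) β ≈ 1# →
      let W = ⟪ w ∣ (λ _ → 1#) , (λ _ → 1#) ⟫
          H = ⟪ e ∣ (λ _ → 1#) , (λ _ → 1#) ⟫ in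
      0# < H * H →
      ∃₂ (DenseHeavy w e α β H W)
    dense-heavy-rectangle {w} {e} {α} {β} 0≤w e≤w -e≤w 0≤α ∑α 0≤β ∑β 0<HH =
      within (densest-rectangle 0≤w e≤w -e≤w 0<HH)
      where
      combine : ∀ {V h μ W F} → 0# ≤ μ → 0# ≤ W → h ≤ V * W → V * μ ≤ F → h * μ ≤ F * W
      combine {V} {h} {μ} {W} {F} 0≤μ 0≤W h≤VW Vμ≤F = R.begin
        h * μ      R.≤⟨ *-monoʳ-≤ 0≤μ h≤VW ⟩
        V * W * μ  R.≈⟨ solve 3 (λ V W μ → V :* W :* μ := V :* μ :* W) refl V W μ ⟩
        V * μ * W  R.≤⟨ *-monoʳ-≤ 0≤W Vμ≤F ⟩
        F * W      R.∎
      H = ⟪ e ∣ (λ _ → 1#) , (λ _ → 1#) ⟫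
      W = ⟪ w ∣ (λ _ → 1#) , (λ _ → 1#) ⟫
      within : (∃₂ λ S₀ T₀ → ∃[ V ] Densest w e S₀ T₀ V) → ∃₂ (DenseHeavy w e α β H W)
      within (S₀ , T₀ , V , densest@(0<V , 0<μ₀ , E₀²≈Vμ₀ , signed²≤)) = thin heavy
        where
        w₀ : Matrix
        w₀ x y = w x y * (𝟙 (S₀ x) * 𝟙 (T₀ y))
        γ = ⟪ w ∣ S₀ ⨯ T₀ ⟫ / ι 32
        Heavy = ∃₂ λ S₁ T₁ → Row-heavy w₀ α γ S₁ T₁ × Column-heavy w₀ β γ S₁ T₁ ×
          ⟪ w₀ ∣ (λ _ → 1#) , (λ _ → 1#) ⟫ ≤ ⟪ w₀ ∣ S₁ ⨯ T₁ ⟫ + γ * ι 2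
        heavy : Heavy
        heavy = heavy-rectangle
          (λ x y → *-nonNeg (0≤w x y) (*-nonNeg (𝟙-nonNeg (S₀ x)) (𝟙-nonNeg (T₀ y))))
          (inj₁ (/-pos 0<μ₀ (ι-pos 31))) 0≤α ∑α 0≤β ∑β
        finish : (∃₂ λ S T → let μ = ⟪ w ∣ S ⨯ T ⟫ ; E = ⟪ e ∣ S ⨯ T ⟫ in
          0# < μ × V * μ ≤ ι 4 * (E * E) × Row-heavy w α (μ / ι 32) S T × Column-heavy w β (μ / ι 32) S T) →
          ∃₂ (DenseHeavy w e α β H W)
        finish (S , T , 0<μ , dense , row , column) = S , T , 0<μ
          , combine (inj₁ 0<μ) (⨯-nonNeg 0≤w (λ _ → true) (λ _ → true)) (signed²≤ (λ _ → true) (λ _ → true)) dense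
          , row , column
        thin : Heavy → ∃₂ (DenseHeavy w e α β H W)
        thin (S₁ , T₁ , row₁ , column₁ , lost₁) =
          finish (heavy-subrectangle {w} {e} {S₀} {T₀} {V} 0≤w densest 0≤α 0≤β S₁ T₁ row₁ column₁ lost₁)

-- Enumeration of messages, transcripts and outcomes without omission or repetition.

∈-allMessages : ∀ {L} (s : Message L) → s ∈ allMessages L
∈-allMessages {zero}  ε           = here ≡.refl
∈-allMessages {suc L} ε           = here ≡.refl
∈-allMessages {suc L} (false ∷ s) = there (∈-++⁺ˡ (∈-map⁺ (false ∷_) (∈-allMessages s)))
∈-allMessages {suc L} (true ∷ s)  =
  there (∈-++⁺ʳ (map (false ∷_) (allMessages L)) (∈-map⁺ (true ∷_) (∈-allMessages s)))

allMessages-unique : ∀ L → Unique (allMessages L)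
allMessages-unique zero    = [] ∷ []
allMessages-unique (suc L) = ¬Any⇒All¬ _ ε∉ ∷ Unique.++⁺
    (Unique.map⁺ ∷-injective (allMessages-unique L)) (Unique.map⁺ ∷-injective (allMessages-unique L)) disjoint
  where
  ∷-injective : ∀ {b} {s t : Message L} → Message._∷_ b s ≡ b ∷ t → s ≡ t
  ∷-injective ≡.refl = ≡.refl
  first : ∀ {b} {s : Message (suc L)} → s ∈ map (b ∷_) (allMessages L) → ∃[ t ] s ≡ b ∷ t
  first s∈ with t , _ , eq ← ∈-map⁻ _ s∈ = t , eq
  disjoint : Disjoint (map (false ∷_) (allMessages L)) (map (true ∷_) (allMessages L))
  disjoint (s∈₀ , s∈₁) with first s∈₀ | first s∈₁
  ... | _ , ≡.refl | _ , ()
  ε∉ : ¬ ε ∈ map (false ∷_) (allMessages L) ++ map (true ∷_) (allMessages L)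
  ε∉ ε∈ with ∈-++⁻ (map (false ∷_) (allMessages L)) ε∈
  ... | inj₁ ε∈₀ with () ← proj₂ (first ε∈₀)
  ... | inj₂ ε∈₁ with () ← proj₂ (first ε∈₁)

∈-allVecs : ∀ {A : Set} {xs : List A} → (∀ x → x ∈ xs) → ∀ {n} (v : Vec A n) → v ∈ allVecs xs n
∈-allVecs ∈xs []      = here ≡.refl
∈-allVecs ∈xs (x ∷ v) = ∈-cartesianProductWith⁺ _∷_ (∈xs x) (∈-allVecs ∈xs v)

allVecs-unique : ∀ {A : Set} {xs : List A} → Unique xs → ∀ n → Unique (allVecs xs n)
allVecs-unique u zero    = [] ∷ []
allVecs-unique u (suc n) = Unique.cartesianProductWith⁺ _∷_ Vec.∷-injective u (allVecs-unique u n)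

∈-allTranscripts : ∀ {k T L} (m : Transcript k T L) → m ∈ allTranscripts k T L
∈-allTranscripts (r , ms) = ∈-cartesianProduct⁺ (∈-allFin r) (∈-allVecs ∈-allMessages ms)

allTranscripts-unique : ∀ k T L → Unique (allTranscripts k T L)
allTranscripts-unique k T L =
  Unique.cartesianProduct⁺ (Unique.allFin⁺ k) (allVecs-unique (allMessages-unique L) T)

∈-allOutcomes : ∀ {a b k T L} (ω : Outcome a b k T L) → ω ∈ allOutcomes a b k T L
∈-allOutcomes (x , y , m) =
  ∈-cartesianProduct⁺ (∈-allFin x) (∈-cartesianProduct⁺ (∈-allFin y) (∈-allTranscripts m))

allOutcomes-unique : ∀ a b k T L → Unique (allOutcomes a b k T L)
allOutcomes-unique a b k T L = Unique.cartesianProduct⁺ (Unique.allFin⁺ a)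
  (Unique.cartesianProduct⁺ (Unique.allFin⁺ b) (allTranscripts-unique k T L))

-- Kraft's inequality for sequences of self-delimiting messages.

module Kraft (ℝ : RealNumbers) where

  open RealNumbers ℝ
  open MarginalInformation ℝ
  open OrderedField ℝ
  open FiniteSums ℝ

  half : Carrier
  half = 1# / ι 2

  0<half : 0# < half
  0<half = /-pos 0<1 (ι-pos 1)

  half+half : half + half ≈ 1#
  half+half = trans (solve 1 (λ h → h :+ h := h :* con (+ 2)) refl half) (/-cancel (ι-pos 1))

  infix 9 half^_
  half^_ : ℕ → Carrier
  half^ zero  = 1#
  half^ suc n = half * half^ n

  half^-pos : ∀ n → 0# < half^ n
  half^-pos zero    = 0<1
  half^-pos (suc n) = *-pos 0<half (half^-pos n)

  half^-+ : ∀ m n → half^ (m ℕ.+ n) ≈ half^ m * half^ n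
  half^-+ zero    n = sym (*-identityˡ _)
  half^-+ (suc m) n = trans (*-congˡ (half^-+ m n)) (sym (*-assoc _ _ _))

  half^-antitone : ∀ {m n} → m ℕ.≤ n → half^ n ≤ half^ m
  half^-antitone {n = zero}  ℕ.z≤n = ≤-refl
  half^-antitone {n = suc n} ℕ.z≤n = ≤-trans
    (*-monoˡ-≤ (inj₁ 0<half) (half^-antitone {n = n} ℕ.z≤n))
    (≤-trans (inj₂ (*-identityʳ half)) (≤-by half (inj₁ 0<half) half+half))
  half^-antitone (ℕ.s≤s m≤n) = *-monoˡ-≤ (inj₁ 0<half) (half^-antitone m≤n)

  -- Induction on the length bound, splitting by the first bit. Weights `g` in place of a
  -- prefix-free set allow the iteration in `kraft`, where the weight of a message is the Kraft sum
  -- of its continuations.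
  kraft-message : ∀ L (g : Message L → Carrier) → (∀ s → 0# ≤ g s) → (∀ s → g s ≤ 1#) →
    (∀ s t → 0# < g s → 0# < g t → Prefix _≡_ (bits s) (bits t) → s ≡ t) →
    ∑ (allMessages L) (λ s → g s * half^ length (bits s)) ≤ 1#
  kraft-message zero    g 0≤g g≤1 prefixFree =
    ≤-resp-≈ (sym (trans (+-identityʳ _) (*-identityʳ _))) refl (g≤1 ε)
  kraft-message (suc L) g 0≤g g≤1 prefixFree = ≤-trans (inj₂ split) (conclude (0# <? g ε))
    where
    tail : Bool → Carrier
    tail b = ∑ (allMessages L) (λ s → g (b ∷ s) * half^ length (bits s))
    branch : ∀ b → ∑ (map (b ∷_) (allMessages L)) (λ s → g s * half^ length (bits s)) ≈ half * tail b
    branch b = trans (∑-map (b ∷_) (allMessages L) _) (trans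
      (∑-cong (allMessages L) λ s →
        solve 3 (λ g h p → g :* (h :* p) := h :* (g :* p)) refl (g (b ∷ s)) half (half^ length (bits s)))
      (∑-*ˡ (allMessages L) half _))
    split : ∑ (allMessages (suc L)) (λ s → g s * half^ length (bits s)) ≈
            g ε + (half * tail false + half * tail true)
    split = +-cong (*-identityʳ _)
      (trans (∑-++ (map (false ∷_) (allMessages L)) _ _) (+-cong (branch false) (branch true)))
    tail≤1 : ∀ b → tail b ≤ 1#
    tail≤1 b = kraft-message L (λ s → g (b ∷ s)) (λ s → 0≤g (b ∷ s)) (λ s → g≤1 (b ∷ s))
      λ s t 0<s 0<t s≤t → ∷-injective (prefixFree (b ∷ s) (b ∷ t) 0<s 0<t (≡.refl ∷ s≤t))
      where
      ∷-injective : ∀ {s t : Message L} → Message._∷_ b s ≡ b ∷ t → s ≡ t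
      ∷-injective ≡.refl = ≡.refl
    conclude : Dec (0# < g ε) → g ε + (half * tail false + half * tail true) ≤ 1#
    -- The empty string is a prefix of every string, so no other string has positive weight.
    conclude (yes 0<gε) = ≤-trans (inj₂ (trans (+-congˡ (trans (+-cong (vanish false) (vanish true)) (+-identityʳ _)))
                                               (+-identityʳ _))) (g≤1 ε)
      where
      zero-mass : ∀ b s → g (b ∷ s) ≈ 0#
      zero-mass b s = ≤-antisym
        (≮⇒≥ λ 0<gs → contradiction (prefixFree ε (b ∷ s) 0<gε 0<gs []) λ ()) (0≤g (b ∷ s))
      vanish : ∀ b → half * tail b ≈ 0#
      vanish b = trans (*-congˡ (trans (∑-cong (allMessages L) λ s →
        trans (*-congʳ (zero-mass b s)) (zeroˡ _)) (∑-0 (allMessages L)))) (zeroʳ half)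
    conclude (no 0≮gε) = ≤-trans (+-mono-≤ (≮⇒≥ 0≮gε)
        (+-mono-≤ (*-monoˡ-≤ (inj₁ 0<half) (tail≤1 false)) (*-monoˡ-≤ (inj₁ 0<half) (tail≤1 true))))
      (inj₂ (trans (+-identityˡ _) (trans (+-cong (*-identityʳ _) (*-identityʳ _)) half+half)))

  vecLength : ∀ {L T} → Vec (Message L) T → ℕ
  vecLength ms = Vec.sum (Vec.map (length ∘ bits) ms)

  -- Prefix-freeness is required only between sequences with the same history. It therefore passes
  -- to the continuations of a fixed first message, whose Kraft sum is at most 1 by induction, and
  -- to the set of possible first messages.
  kraft : ∀ {L} T (U : Vec (Message L) T → Bool) →
    (∀ ms ms′ (i : Fin T) → U ms ≡ true → U ms′ ≡ true →
      take (toℕ i) (toList ms) ≡ take (toℕ i) (toList ms′) →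
      Prefix _≡_ (bits (lookup ms i)) (bits (lookup ms′ i)) → lookup ms i ≡ lookup ms′ i) →
    ∑ (allVecs (allMessages L) T) (λ ms → 𝟙 (U ms) * half^ vecLength ms) ≤ 1#
  kraft zero    U prefixFree =
    ≤-trans (inj₂ (trans (+-identityʳ _) (*-identityʳ _))) (𝟙≤1 (U []))
  kraft {L} (suc T) U prefixFree = ≤-trans (inj₂ factor)
    (kraft-message L first (λ s → ∑-nonNeg vecs λ ms → *-nonNeg (𝟙-nonNeg (U (s ∷ ms))) (inj₁ (half^-pos (vecLength ms))))
      (λ s → kraft T (λ ms → U (s ∷ ms)) λ ms ms′ i Ums Ums′ eq →
        prefixFree (s ∷ ms) (s ∷ ms′) (suc i) Ums Ums′ (≡.cong (s ∷_) eq))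
      first-prefixFree)
    where
    vecs = allVecs (allMessages L) T
    first : Message L → Carrier
    first s = ∑ vecs (λ ms → 𝟙 (U (s ∷ ms)) * half^ vecLength ms)
    factor : ∑ (allVecs (allMessages L) (suc T)) (λ ms → 𝟙 (U ms) * half^ vecLength ms) ≈
             ∑ (allMessages L) (λ s → first s * half^ length (bits s))
    factor = trans (∑-cartesianProductWith _∷_ (allMessages L) vecs _)
      (∑-cong (allMessages L) λ s → trans
        (∑-cong vecs λ ms → trans (*-congˡ (half^-+ (length (bits s)) _))
          (solve 3 (λ u p q → u :* (p :* q) := u :* q :* p) refl
            (𝟙 (U (s ∷ ms))) (half^ length (bits s)) (half^ vecLength ms)))
        (∑-*ʳ vecs _ _))
    occurs : ∀ s → 0# < first s → ∃[ ms ] U (s ∷ ms) ≡ true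
    occurs s 0<first with ∑-pos vecs 0<first
    ... | ms , 0<term with U (s ∷ ms) in Ums
    ...   | true  = ms , Ums
    ...   | false = contradiction (<-respʳ-≈ (zeroˡ _) 0<term) (irrefl refl)
    first-prefixFree : ∀ s t → 0# < first s → 0# < first t → Prefix _≡_ (bits s) (bits t) → s ≡ t
    first-prefixFree s t 0<s 0<t s≤t with occurs s 0<s | occurs t 0<t
    ... | ms , Ums | ms′ , Ums′ = prefixFree (s ∷ ms) (t ∷ ms′) zero Ums Ums′ ≡.refl s≤t

-- Events, marginals and the factorisation of a protocol.

does⇒ : ∀ {P : Set} (P? : Dec P) → does P? ≡ true → P
does⇒ (yes p) _ = p

take-toList-injective : ∀ {A : Set} {n} (u v : Vec A n) → take n (toList u) ≡ take n (toList v) → u ≡ v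
take-toList-injective []      []      _  = ≡.refl
take-toList-injective (x ∷ u) (y ∷ v) eq with List.∷-injective eq
... | ≡.refl , eq′ = ≡.cong (x ∷_) (take-toList-injective u v eq′)

agreeUpTo-end : ∀ {k T L} {m m′ : Transcript k T L} → AgreeUpTo T m m′ → m ≡ m′
agreeUpTo-end {m = r , ms} {r′ , ms′} (r≡r′ , eq) = ≡.cong₂ _,_ r≡r′ (take-toList-injective ms ms′ eq)

module Probability (ℝ : RealNumbers) where

  open RealNumbers ℝ
  open MarginalInformation ℝ
  open OrderedField ℝ
  open FiniteSums ℝ

  module _ {A : Set} where

    ∏-* : ∀ (xs : List A) {g u v : A → Carrier} → (∀ x → g x ≈ u x * v x) → ∏ xs g ≈ ∏ xs u * ∏ xs v
    ∏-* []       eq = sym (*-identityˡ 1#)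
    ∏-* (x ∷ xs) eq = trans (*-cong (eq x) (∏-* xs eq))
      (solve 4 (λ a b c d → a :* b :* (c :* d) := a :* c :* (b :* d)) refl _ _ _ _)

    ∏-unit : ∀ (xs : List A) {g : A → Carrier} → (∀ x → 0# ≤ g x × g x ≤ 1#) → 0# ≤ ∏ xs g × ∏ xs g ≤ 1#
    ∏-unit []       bounds = inj₁ 0<1 , ≤-refl
    ∏-unit (x ∷ xs) bounds = *-nonNeg (proj₁ (bounds x)) (proj₁ rest) ,
      ≤-trans (*-mono-≤ (proj₁ rest) (inj₁ 0<1) (proj₂ (bounds x)) (proj₂ rest)) (inj₂ (*-identityˡ 1#))
      where rest = ∏-unit xs bounds

  module _ {a b k T L : ℕ} where

    private
      Ω = allOutcomes a b k T L
      D = Distribution a b k T L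
      M = Transcript k T L
      Ev = Event {a} {b} {k} {T} {L}

    ℙ-𝟙 : ∀ (p : D) (E : Ev) → ℙ p E ≈ ∑ Ω (λ ω → 𝟙 (E ω) * mass p ω)
    ℙ-𝟙 p E = ∑-cong Ω λ ω → if-𝟙 (E ω) (mass p ω)

    event-nonNeg : ∀ (p : D) (E : Ev) ω → 0# ≤ 𝟙 (E ω) * mass p ω
    event-nonNeg p E ω = *-nonNeg (𝟙-nonNeg (E ω)) (nonNegative p ω)

    ℙ-nonNeg : ∀ (p : D) (E : Ev) → 0# ≤ ℙ p E
    ℙ-nonNeg p E = ≤-trans (∑-nonNeg Ω (event-nonNeg p E)) (inj₂ (sym (ℙ-𝟙 p E)))

    mass≤ℙ : ∀ (p : D) (E : Ev) {ω} → E ω ≡ true → mass p ω ≤ ℙ p E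
    mass≤ℙ p E {ω} Eω = ≤-trans (inj₂ (sym (trans (*-congʳ (reflexive (≡.cong 𝟙 Eω))) (*-identityˡ _))))
      (≤-trans (term≤∑ (event-nonNeg p E) (∈-allOutcomes ω)) (inj₂ (sym (ℙ-𝟙 p E))))

    ℙ-∩ʳ : ∀ (p : D) (E G : Ev) → ℙ p (E ∩ G) ≤ ℙ p G
    ℙ-∩ʳ p E G = ≤-resp-≈ (sym (ℙ-𝟙 p (E ∩ G))) (sym (ℙ-𝟙 p G)) (∑-mono Ω λ ω →
      *-monoʳ-≤ (nonNegative p ω) (≤-trans (inj₂ (𝟙-∧ (E ω) (G ω)))
        (≤-trans (*-monoʳ-≤ (𝟙-nonNeg (G ω)) (𝟙≤1 (E ω))) (inj₂ (*-identityˡ _)))))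

    ℙ-point : ∀ (p : D) {E : Ev} {ω} → Isolates E ω → ℙ p E ≈ mass p ω
    ℙ-point p {E} {ω} E≡ω = trans (ℙ-𝟙 p E)
      (∑-isolate E≡ω (allOutcomes-unique a b k T L) (∈-allOutcomes ω) (mass p))

    module _ {A : Set} {xs : List A} (xs-unique : Unique xs) (∈xs : ∀ v → v ∈ xs)
             {E : A → Ev} (E-partition : ∀ ω → ∃[ v ] Isolates (λ v → E v ω) v) where

      -- After the sums are exchanged, each outcome contributes through the single `v` whose event
      -- contains it.
      ℙ-partition : ∀ (p : D) (G : Ev) → ∑ xs (λ v → ℙ p (E v ∩ G)) ≈ ℙ p G
      ℙ-partition p G = trans
        (∑-cong xs λ v → trans (ℙ-𝟙 p (E v ∩ G)) (∑-cong Ω λ ω →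
          trans (*-congʳ (𝟙-∧ (E v ω) (G ω))) (*-assoc _ _ _)))
        (trans (∑-swap xs Ω _) (trans
          (∑-cong Ω λ ω → ∑-isolate (proj₂ (E-partition ω)) xs-unique (∈xs _) (λ _ → 𝟙 (G ω) * mass p ω))
          (sym (ℙ-𝟙 p G))))

      ℙ-total : ∀ (p : D) → ∑ xs (λ v → ℙ p (E v)) ≈ 1#
      ℙ-total p = trans
        (∑-cong xs λ v → ℙ-𝟙 p (E v))
        (trans (∑-swap xs Ω _) (trans
          (∑-cong Ω λ ω → ∑-isolate (proj₂ (E-partition ω)) xs-unique (∈xs _) (λ _ → mass p ω))
          (total p)))

    dec-isolates : ∀ {A : Set} {P : A → Set} (P? : ∀ w → Dec (P w)) {v} → P v → (∀ w → P w → v ≡ w) →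
                   Isolates (λ w → does (P? w)) v
    dec-isolates P? Pv unique = dec-true (P? _) Pv , λ w eq → unique w (does⇒ (P? w) eq)

    x-partition : ∀ (ω : Outcome a b k T L) → ∃[ x ] Isolates (λ x → ⟨x= x ⟩ ω) x
    x-partition (x′ , _) = x′ , dec-isolates (Fin._≟ x′) ≡.refl λ _ → ≡.sym

    y-partition : ∀ (ω : Outcome a b k T L) → ∃[ y ] Isolates (λ y → ⟨y= y ⟩ ω) y
    y-partition (_ , y′ , _) = y′ , dec-isolates (Fin._≟ y′) ≡.refl λ _ → ≡.sym

    m-partition : ∀ (ω : Outcome a b k T L) → ∃[ m ] Isolates (λ m → ⟨m= m ⟩ ω) m
    m-partition (_ , _ , m′) = m′ ,
      dec-isolates (λ m → agreeUpTo? T m m′) (≡.refl , ≡.refl) λ m eq → ≡.sym (agreeUpTo-end eq)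

    m₀-partition : ∀ ms (ω : Outcome a b k T L) → ∃[ r ] Isolates (λ r → ⟨m≤ 0 ∶ (r , ms) ⟩ ω) r
    m₀-partition ms (_ , _ , m′@(r′ , _)) = r′ ,
      dec-isolates (λ r → agreeUpTo? 0 (r , ms) m′) (≡.refl , ≡.refl) λ r eq → ≡.sym (proj₁ eq)

    ∑-ℙx : ∀ (p : D) → ∑ (allFin a) (λ x → ℙ p ⟨x= x ⟩) ≈ 1#
    ∑-ℙx = ℙ-total (Unique.allFin⁺ a) ∈-allFin x-partition

    ∑-ℙy : ∀ (p : D) → ∑ (allFin b) (λ y → ℙ p ⟨y= y ⟩) ≈ 1#
    ∑-ℙy = ℙ-total (Unique.allFin⁺ b) ∈-allFin y-partition

    ∑-ℙm : ∀ (p : D) → ∑ (allTranscripts k T L) (λ m → ℙ p ⟨m= m ⟩) ≈ 1#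
    ∑-ℙm = ℙ-total (allTranscripts-unique k T L) ∈-allTranscripts m-partition

    ∑-ℙm₀ : ∀ (p : D) ms → ∑ (allFin k) (λ r → ℙ p ⟨m≤ 0 ∶ (r , ms) ⟩) ≈ 1#
    ∑-ℙm₀ p ms = ℙ-total (Unique.allFin⁺ k) ∈-allFin (m₀-partition ms) p

  module _ {a b k T L : ℕ} where

    private
      D = Distribution a b k T L
      M = Transcript k T L
      Ev = Event {a} {b} {k} {T} {L}

    ∩-elim : ∀ (E G : Ev) {ω} → (E ∩ G) ω ≡ true → E ω ≡ true × G ω ≡ true
    ∩-elim E G {ω} eq with E ω | G ω
    ... | true | true = ≡.refl , ≡.refl

    ∩-intro : ∀ (E G : Ev) {ω} → E ω ≡ true → G ω ≡ true → (E ∩ G) ω ≡ true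
    ∩-intro E G Eω Gω = ≡.cong₂ _∧_ Eω Gω

    ⟨x⟩-intro : ∀ (x : Fin a) (y : Fin b) (m : M) → ⟨x= x ⟩ (x , y , m) ≡ true
    ⟨x⟩-intro x y m = dec-true (x Fin.≟ x) ≡.refl

    ⟨y⟩-intro : ∀ (x : Fin a) (y : Fin b) (m : M) → ⟨y= y ⟩ (x , y , m) ≡ true
    ⟨y⟩-intro x y m = dec-true (y Fin.≟ y) ≡.refl

    ⟨m⟩-intro : ∀ i (x : Fin a) (y : Fin b) (m : M) → ⟨m≤ i ∶ m ⟩ (x , y , m) ≡ true
    ⟨m⟩-intro i x y m = dec-true (agreeUpTo? i m m) (≡.refl , ≡.refl)

    outcome-≡ : ∀ {x y} {m : M} {ω : Outcome a b k T L} →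
                ⟨x= x ⟩ ω ≡ true → ⟨y= y ⟩ ω ≡ true → ⟨m= m ⟩ ω ≡ true → (x , y , m) ≡ ω
    outcome-≡ {x} {y} {m} {x′ , y′ , m′} x≡ y≡ m≡
      with ≡.refl ← does⇒ (x Fin.≟ x′) x≡ | ≡.refl ← does⇒ (y Fin.≟ y′) y≡
         | ≡.refl ← agreeUpTo-end (does⇒ (agreeUpTo? T m m′) m≡) = ≡.refl

    ℙ-xym : ∀ (p : D) x y m → ℙ p (⟨x= x ⟩ ∩ ⟨y= y ⟩ ∩ ⟨m= m ⟩) ≈ mass p (x , y , m)
    ℙ-xym p x y m = ℙ-point p
      ( ∩-intro ⟨x= x ⟩ (⟨y= y ⟩ ∩ ⟨m= m ⟩) {x , y , m} (⟨x⟩-intro x y m)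
          (∩-intro ⟨y= y ⟩ ⟨m= m ⟩ {x , y , m} (⟨y⟩-intro x y m) (⟨m⟩-intro T x y m))
      , λ ω eq → let x≡ , ym≡ = ∩-elim ⟨x= x ⟩ (⟨y= y ⟩ ∩ ⟨m= m ⟩) {ω} eq
                     y≡ , m≡  = ∩-elim ⟨y= y ⟩ ⟨m= m ⟩ {ω} ym≡
                 in outcome-≡ {x} {y} {m} {ω} x≡ y≡ m≡ )

    ℙ-yxm : ∀ (p : D) x y m → ℙ p (⟨y= y ⟩ ∩ ⟨x= x ⟩ ∩ ⟨m= m ⟩) ≈ mass p (x , y , m)
    ℙ-yxm p x y m = ℙ-point p
      ( ∩-intro ⟨y= y ⟩ (⟨x= x ⟩ ∩ ⟨m= m ⟩) {x , y , m} (⟨y⟩-intro x y m)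
          (∩-intro ⟨x= x ⟩ ⟨m= m ⟩ {x , y , m} (⟨x⟩-intro x y m) (⟨m⟩-intro T x y m))
      , λ ω eq → let y≡ , xm≡ = ∩-elim ⟨y= y ⟩ (⟨x= x ⟩ ∩ ⟨m= m ⟩) {ω} eq
                     x≡ , m≡  = ∩-elim ⟨x= x ⟩ ⟨m= m ⟩ {ω} xm≡
                 in outcome-≡ {x} {y} {m} {ω} x≡ y≡ m≡ )

    ℙ-[xy]m : ∀ (p : D) x y m → ℙ p ((⟨x= x ⟩ ∩ ⟨y= y ⟩) ∩ ⟨m= m ⟩) ≈ mass p (x , y , m)
    ℙ-[xy]m p x y m = ℙ-point p
      ( ∩-intro (⟨x= x ⟩ ∩ ⟨y= y ⟩) ⟨m= m ⟩ {x , y , m}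
          (∩-intro ⟨x= x ⟩ ⟨y= y ⟩ {x , y , m} (⟨x⟩-intro x y m) (⟨y⟩-intro x y m)) (⟨m⟩-intro T x y m)
      , λ ω eq → let xy≡ , m≡ = ∩-elim (⟨x= x ⟩ ∩ ⟨y= y ⟩) ⟨m= m ⟩ {ω} eq
                     x≡ , y≡  = ∩-elim ⟨x= x ⟩ ⟨y= y ⟩ {ω} xy≡
                 in outcome-≡ {x} {y} {m} {ω} x≡ y≡ m≡ )

    ℙ-ym : ∀ (p : D) y m → ℙ p (⟨y= y ⟩ ∩ ⟨m= m ⟩) ≈ ∑ (allFin a) (λ x → mass p (x , y , m))
    ℙ-ym p y m = trans (sym (ℙ-partition (Unique.allFin⁺ a) ∈-allFin {E = ⟨x=_⟩} x-partition p (⟨y= y ⟩ ∩ ⟨m= m ⟩)))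
      (∑-cong (allFin a) λ x → ℙ-xym p x y m)

    ℙ-xm : ∀ (p : D) x m → ℙ p (⟨x= x ⟩ ∩ ⟨m= m ⟩) ≈ ∑ (allFin b) (λ y → mass p (x , y , m))
    ℙ-xm p x m = trans (sym (ℙ-partition (Unique.allFin⁺ b) ∈-allFin y-partition p (⟨x= x ⟩ ∩ ⟨m= m ⟩)))
      (∑-cong (allFin b) λ y → ℙ-yxm p x y m)

    ℙ-m : ∀ (p : D) m → ℙ p ⟨m= m ⟩ ≈ ∑ (allFin a) (λ x → ∑ (allFin b) λ y → mass p (x , y , m))
    ℙ-m p m = trans (sym (ℙ-partition (Unique.allFin⁺ a) ∈-allFin x-partition p ⟨m= m ⟩))
      (∑-cong (allFin a) λ x → ℙ-xm p x m)

    -- Clearing the denominator turns the conditional expectation into a signed mass of the full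
    -- rectangle.
    bias-ℙ : ∀ (p : D) f m → 0# < ℙ p ⟨m= m ⟩ →
      bias p f m * ℙ p ⟨m= m ⟩ ≈ ∑ (allFin a) (λ x → ∑ (allFin b) λ y → mass p (x , y , m) * sign {a} {b} {k} {T} {L} (f x y))
    bias-ℙ p f m 0<m = trans (sym (∑-*ʳ (allFin a) _ _)) (∑-cong (allFin a) λ x →
      trans (sym (∑-*ʳ (allFin b) _ _)) (∑-cong (allFin b) λ y → trans
        (solve 3 (λ c s m → c :* s :* m := c :* m :* s) refl _ (sign {a} {b} {k} {T} {L} (f x y)) (ℙ p ⟨m= m ⟩))
        (*-congʳ (trans (/-cancel 0<m) (ℙ-[xy]m p x y m)))))

    ℙ∣-unit : ∀ (p : D) E G → 0# ≤ ℙ[ E ∣ G ]of p × ℙ[ E ∣ G ]of p ≤ 1#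
    ℙ∣-unit p E G = bounds (0# <? ℙ p G)
      where
      bounds : Dec (0# < ℙ p G) → 0# ≤ ℙ[ E ∣ G ]of p × ℙ[ E ∣ G ]of p ≤ 1#
      bounds (yes 0<G) = *-nonNeg (ℙ-nonNeg p (E ∩ G)) (inj₁ (⁻¹-pos 0<G)) ,
        /-≤ 0<G (≤-trans (ℙ-∩ʳ p E G) (inj₂ (sym (*-identityˡ _))))
      -- A condition of probability 0 makes the numerator 0, hence the quotient 0, whatever `0# ⁻¹`
      -- is.
      bounds (no 0≮G) = inj₂ (sym ≈0) , ≤-trans (inj₂ ≈0) (inj₁ 0<1)
        where
        ≈0 : ℙ[ E ∣ G ]of p ≈ 0#
        ≈0 = trans (*-congʳ (≤-antisym (≤-trans (ℙ-∩ʳ p E G) (≮⇒≥ 0≮G)) (ℙ-nonNeg p (E ∩ G)))) (zeroˡ _)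

    -- A factor `1#` in the other player's rounds lets the products of both players run over all
    -- rounds, so that `∏-*` can separate them.
    aliceFactor : D → Fin a → M → ℕ → Parity → Carrier
    aliceFactor p x m i 0ℙ = ℙ[ ⟨m≤ suc i ∶ m ⟩ ∣ ⟨x= x ⟩ ∩ ⟨m≤ i ∶ m ⟩ ]of p
    aliceFactor p x m i 1ℙ = 1#

    bobFactor : D → Fin b → M → ℕ → Parity → Carrier
    bobFactor p y m i 0ℙ = 1#
    bobFactor p y m i 1ℙ = ℙ[ ⟨m≤ suc i ∶ m ⟩ ∣ ⟨y= y ⟩ ∩ ⟨m≤ i ∶ m ⟩ ]of p

    alice : D → Fin a → M → Carrier
    alice p x m = ∏ (upTo T) λ i → aliceFactor p x m i (parity i)

    bob : D → Fin b → M → Carrier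
    bob p y m = ∏ (upTo T) λ i → bobFactor p y m i (parity i)

    aliceFactor-unit : ∀ p x m i π → 0# ≤ aliceFactor p x m i π × aliceFactor p x m i π ≤ 1#
    aliceFactor-unit p x m i 0ℙ = ℙ∣-unit p ⟨m≤ suc i ∶ m ⟩ (⟨x= x ⟩ ∩ ⟨m≤ i ∶ m ⟩)
    aliceFactor-unit p x m i 1ℙ = inj₁ 0<1 , ≤-refl

    bobFactor-unit : ∀ p y m i π → 0# ≤ bobFactor p y m i π × bobFactor p y m i π ≤ 1#
    bobFactor-unit p y m i 0ℙ = inj₁ 0<1 , ≤-refl
    bobFactor-unit p y m i 1ℙ = ℙ∣-unit p ⟨m≤ suc i ∶ m ⟩ (⟨y= y ⟩ ∩ ⟨m≤ i ∶ m ⟩)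

    mass-factors : ∀ {p : D} → IsProtocol p → ∀ x y m →
      mass p (x , y , m) ≈ ℙ p (⟨x= x ⟩ ∩ ⟨y= y ⟩) * ℙ p ⟨m≤ 0 ∶ m ⟩ * (alice p x m * bob p y m)
    mass-factors {p} protocol x y m = trans (IsProtocol.factorises protocol x y m)
      (*-congˡ (∏-* (upTo T) split))
      where
      -- The local function of protocolProduct, which has no accessible name.
      factors : ∃[ g ] protocolProduct p x y m ≡ ℙ p (⟨x= x ⟩ ∩ ⟨y= y ⟩) * ℙ p ⟨m≤ 0 ∶ m ⟩ * ∏ (upTo T) g
      factors = _ , ≡.refl
      split : ∀ i → proj₁ factors i ≈ aliceFactor p x m i (parity i) * bobFactor p y m i (parity i)
      split i with parity i
      ... | 0ℙ = sym (*-identityʳ _)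
      ... | 1ℙ = sym (*-identityˡ _)

    -- The players' factors are products of conditional probabilities, hence at most 1. This is
    -- where p(m₀) enters the ratio bounds.
    mass≤ℙxy*ℙm₀ : ∀ {p : D} → IsProtocol p → ∀ x y m →
      mass p (x , y , m) ≤ ℙ p (⟨x= x ⟩ ∩ ⟨y= y ⟩) * ℙ p ⟨m≤ 0 ∶ m ⟩
    mass≤ℙxy*ℙm₀ {p} protocol x y m = ≤-trans (inj₂ (mass-factors protocol x y m))
      (≤-trans (*-monoˡ-≤ (*-nonNeg (ℙ-nonNeg p _) (ℙ-nonNeg p _))
          (≤-trans (*-mono-≤ (proj₁ bob-unit) (inj₁ 0<1) (proj₂ alice-unit) (proj₂ bob-unit)) (inj₂ (*-identityˡ 1#))))
        (inj₂ (*-identityʳ _)))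
      where
      alice-unit = ∏-unit (upTo T) λ i → aliceFactor-unit p x m i (parity i)
      bob-unit = ∏-unit (upTo T) λ i → bobFactor-unit p y m i (parity i)

-- The numerical inequalities and their logarithmic form.

module Numerics (ℝ : RealNumbers) where

  open RealNumbers ℝ
  open MarginalInformation ℝ
  open OrderedField ℝ
  open Kraft ℝ

  -- (n / d) / (g / h) is q(x|ym) / p(x|y), with n = q(xym), d = q(ym), g = p(xy), h = p(y).
  conditional-ratio : ∀ {n d g h w N c M μ} → n ≈ w * c → d ≈ N * c → 0# < c → 0# < w → 0# < g → 0# < h →
    0# < μ → w ≤ g * M → μ / ι 32 * h ≤ N →
    0# < n / d / (g / h) × n / d / (g / h) * μ ≤ ι 32 * M
  conditional-ratio {n} {d} {g} {h} {w} {N} {c} {M} {μ} n≈ d≈ 0<c 0<w 0<g 0<h 0<μ w≤ heavy = 0<r , r-bound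
    where
    u = n / d
    v = g / h
    r = u / v
    0<N : 0# < N
    0<N = <-≤-trans (*-pos (/-pos 0<μ (ι-pos 31)) 0<h) heavy
    0<n = <-respʳ-≈ (sym n≈) (*-pos 0<w 0<c)
    0<d = <-respʳ-≈ (sym d≈) (*-pos 0<N 0<c)
    0<v = /-pos 0<g 0<h
    0<r = /-pos (/-pos 0<n 0<d) 0<v
    0≤M : 0# ≤ M
    0≤M = inj₁ (*-cancelˡ-pos (inj₁ 0<g) (<-≤-trans 0<w w≤))
    μh≤32N : μ * h ≤ ι 32 * N
    μh≤32N = ≤-trans (inj₂ (trans (*-congʳ (sym (/-cancel (ι-pos 31))))
        (solve 3 (λ t k h → t :* k :* h := k :* (t :* h)) refl (μ / ι 32) (ι 32) h)))
      (*-monoˡ-≤ (ι-nonNeg 32) heavy)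
    r-bound : r * μ ≤ ι 32 * M
    r-bound = *-cancelˡ-≤ (*-pos (*-pos 0<v 0<d) 0<h) (R.begin
      v * d * h * (r * μ)       R.≈⟨ solve 5 (λ v d h r μ → v :* d :* h :* (r :* μ) := r :* v :* d :* (h :* μ)) refl v d h r μ ⟩
      r * v * d * (h * μ)       R.≈⟨ *-congʳ (trans (*-congʳ (/-cancel 0<v)) (trans (/-cancel 0<d) n≈)) ⟩
      w * c * (h * μ)           R.≈⟨ solve 4 (λ w c h μ → w :* c :* (h :* μ) := w :* (c :* (μ :* h))) refl w c h μ ⟩
      w * (c * (μ * h))         R.≤⟨ *-mono-≤ (*-nonNeg (inj₁ 0<c) (inj₁ (*-pos 0<μ 0<h)))
                                       (*-nonNeg (inj₁ 0<g) 0≤M) w≤ (*-monoˡ-≤ (inj₁ 0<c) μh≤32N) ⟩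
      g * M * (c * (ι 32 * N))  R.≈⟨ *-cong (*-congʳ (sym (/-cancel 0<h))) refl ⟩
      v * h * M * (c * (ι 32 * N)) R.≈⟨ solve 6 (λ v h M c t N → v :* h :* M :* (c :* (t :* N)) := v :* (N :* c) :* h :* (t :* M))
                                       refl v h M c (ι 32) N ⟩
      v * (N * c) * h * (ι 32 * M) R.≈⟨ *-congʳ (*-congʳ (*-congˡ (sym d≈))) ⟩
      v * d * h * (ι 32 * M)    R.∎)

  -- For a kept `m`: `ε` is the advantage, `W` is p(m), `H` is p(m) h(m), `μ` is the mass of the
  -- rectangle, `B` is the absolute bias of q, `M` is p(m₀) and `t` is 2^(-C). In `dense`, E² has
  -- been replaced by B² μ².
  module PieceBounds {ε W H μ B M t : Carrier} (0<ε : 0# < ε) (0<W : 0# < W) (0<H : 0# < H) (0<μ : 0# < μ)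
           (εW≤4H : ε * W ≤ ι 4 * H) (εMt≤4H : ε * (M * t) ≤ ι 4 * H)
           (0<t : 0# < t)
           (μ≤W : μ ≤ W) (dense : H * H * μ ≤ ι 4 * (B * B * (μ * μ)) * W) where

    private
      BB = B * B

    -- Cancelling `μ` in `dense` leaves H² ≤ 4 B² μ W, and `εW≤4H` trades `W` for one factor `H`. So
    -- B² grows at least like 1/μ, which is what pays for a small `μ` below.
    εH≤16BBμ : ε * H ≤ ι 16 * (BB * μ)
    εH≤16BBμ = *-cancelˡ-≤ (*-pos 0<H 0<μ) (R.begin
      H * μ * (ε * H)                    R.≈⟨ solve 3 (λ H μ ε → H :* μ :* (ε :* H) := ε :* (H :* H :* μ)) refl H μ ε ⟩
      ε * (H * H * μ)                    R.≤⟨ *-monoˡ-≤ (inj₁ 0<ε) dense ⟩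
      ε * (ι 4 * (BB * (μ * μ)) * W)     R.≈⟨ solve 4 (λ ε B μ W → ε :* (con (+ 4) :* (B :* (μ :* μ)) :* W) :=
                                                con (+ 4) :* (B :* (μ :* μ)) :* (ε :* W)) refl ε BB μ W ⟩
      ι 4 * (BB * (μ * μ)) * (ε * W)     R.≤⟨ *-monoˡ-≤ (*-nonNeg (ι-nonNeg 4) (*-nonNeg (square-nonNeg B) (square-nonNeg μ))) εW≤4H ⟩
      ι 4 * (BB * (μ * μ)) * (ι 4 * H)   R.≈⟨ solve 3 (λ B μ H → con (+ 4) :* (B :* (μ :* μ)) :* (con (+ 4) :* H) :=
                                                H :* μ :* (con (+ 16) :* (B :* μ))) refl BB μ H ⟩
      H * μ * (ι 16 * (BB * μ))          R.∎)

    -- From r ≤ 32 M/μ: the threshold replaces `M` by 4 H/(ε t), and ε H/μ is at most 16 B². Hence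
    -- 2048 = 32 · 4 · 16.
    ratio-bound : ∀ {r} → 0# < r → r * μ ≤ ι 32 * M → r * (ε * ε) * t ≤ ι 2048 * BB
    ratio-bound {r} 0<r rμ≤32M = *-cancelˡ-≤ 0<μ (R.begin
      μ * (r * (ε * ε) * t)       R.≈⟨ solve 4 (λ μ r ε t → μ :* (r :* (ε :* ε) :* t) := ε :* (ε :* t) :* (r :* μ)) refl μ r ε t ⟩
      ε * (ε * t) * (r * μ)       R.≤⟨ *-monoˡ-≤ (inj₁ (*-pos 0<ε (*-pos 0<ε 0<t))) rμ≤32M ⟩
      ε * (ε * t) * (ι 32 * M)    R.≈⟨ solve 4 (λ ε t k M → ε :* (ε :* t) :* (k :* M) := k :* ε :* (ε :* (M :* t))) refl ε t (ι 32) M ⟩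
      ι 32 * ε * (ε * (M * t))    R.≤⟨ *-monoˡ-≤ (*-nonNeg (ι-nonNeg 32) (inj₁ 0<ε)) εMt≤4H ⟩
      ι 32 * ε * (ι 4 * H)        R.≈⟨ solve 2 (λ ε H → con (+ 32) :* ε :* (con (+ 4) :* H) := con (+ 128) :* (ε :* H)) refl ε H ⟩
      ι 128 * (ε * H)             R.≤⟨ *-monoˡ-≤ (ι-nonNeg 128) εH≤16BBμ ⟩
      ι 128 * (ι 16 * (BB * μ))   R.≈⟨ sym (*-assoc _ _ _) ⟩
      ι 128 * ι 16 * (BB * μ)     R.≈⟨ *-congʳ (sym (ι-* 128 16)) ⟩
      ι 2048 * (BB * μ)           R.≈⟨ solve 3 (λ k B μ → k :* (B :* μ) := μ :* (k :* B)) refl (ι 2048) BB μ ⟩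
      μ * (ι 2048 * BB)           R.∎)

    mass-ratio-bound : ∀ {c} → c * ε * μ ≤ ι 2 * H → c * (ε * ε) ≤ ι 32 * BB
    mass-ratio-bound {c} cεμ≤2H = *-cancelˡ-≤ 0<μ (R.begin
      μ * (c * (ε * ε))          R.≈⟨ solve 3 (λ μ c ε → μ :* (c :* (ε :* ε)) := ε :* (c :* ε :* μ)) refl μ c ε ⟩
      ε * (c * ε * μ)            R.≤⟨ *-monoˡ-≤ (inj₁ 0<ε) cεμ≤2H ⟩
      ε * (ι 2 * H)              R.≈⟨ solve 2 (λ ε H → ε :* (con (+ 2) :* H) := con (+ 2) :* (ε :* H)) refl ε H ⟩
      ι 2 * (ε * H)              R.≤⟨ *-monoˡ-≤ (ι-nonNeg 2) εH≤16BBμ ⟩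
      ι 2 * (ι 16 * (BB * μ))    R.≈⟨ solve 2 (λ B μ → con (+ 2) :* (con (+ 16) :* (B :* μ)) := μ :* (con (+ 32) :* B)) refl BB μ ⟩
      μ * (ι 32 * BB)            R.∎)

    -- Bounding `μ` by `W` makes the lower bound on the bias independent of the rectangle: B ≥ ε/8.
    bias-bound : ε * ε ≤ ι 64 * BB
    bias-bound = *-cancelˡ-≤ 0<μ (R.begin
      μ * (ε * ε)                R.≤⟨ *-monoʳ-≤ (inj₁ (*-pos 0<ε 0<ε)) μ≤W ⟩
      W * (ε * ε)                R.≈⟨ solve 2 (λ W ε → W :* (ε :* ε) := ε :* (ε :* W)) refl W ε ⟩
      ε * (ε * W)                R.≤⟨ *-monoˡ-≤ (inj₁ 0<ε) εW≤4H ⟩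
      ε * (ι 4 * H)              R.≈⟨ solve 2 (λ ε H → ε :* (con (+ 4) :* H) := con (+ 4) :* (ε :* H)) refl ε H ⟩
      ι 4 * (ε * H)              R.≤⟨ *-monoˡ-≤ (ι-nonNeg 4) εH≤16BBμ ⟩
      ι 4 * (ι 16 * (BB * μ))    R.≈⟨ solve 2 (λ B μ → con (+ 4) :* (con (+ 16) :* (B :* μ)) := μ :* (con (+ 64) :* B)) refl BB μ ⟩
      μ * (ι 64 * BB)            R.∎)

  log-half^ : ∀ n → log₂ (half^ n) ≈ - ι n
  log-half^ n = trans (solve 2 (λ h m → h := h :+ m :- m) refl (log₂ (half^ n)) (ι n))
    (trans (+-congʳ sum≈0) (+-identityˡ _))
    where
    half^*ι : ∀ n → half^ n * ι (2 ℕ.^ n) ≈ 1#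
    half^*ι zero    = trans (*-identityˡ _) (+-identityʳ 1#)
    half^*ι (suc n) = trans (*-congˡ (ι-* 2 (2 ℕ.^ n))) (trans
      (solve 4 (λ h p t m → h :* p :* (t :* m) := h :* t :* (p :* m)) refl half (half^ n) (ι 2) (ι (2 ℕ.^ n)))
      (trans (*-cong (/-cancel (ι-pos 1)) (half^*ι n)) (*-identityˡ 1#)))
    0<ι2^ : 0# < ι (2 ℕ.^ n)
    0<ι2^ = *-cancelˡ-pos (inj₁ (half^-pos n)) (<-respʳ-≈ (sym (half^*ι n)) 0<1)
    sum≈0 : log₂ (half^ n) + ι n ≈ 0#
    sum≈0 = trans (+-congˡ (sym (log₂-ι n))) (trans (sym (log₂-* (half^-pos n) 0<ι2^))
      (trans (log₂-cong (trans (half^*ι n) (sym (+-identityʳ 1#)))) (log₂-ι 0)))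

  log-square : ∀ {x} → 0# < x → log₂ (x * x) ≈ ι 2 * log₂ x
  log-square 0<x = trans (log₂-* 0<x 0<x) (solve 1 (λ l → l :+ l := con (+ 2) :* l) refl _)

  -- β + 3 ≥ e is the only lower bound on the bias; its coefficient 178 I - 4 comes
  -- from the 180 I copies of - β minus those spent on ρ₁, ρ₂ and I χ.
  logarithmic-bound : ∀ {I ρ₁ ρ₂ χ β e c} → ι 1 ≤ I → e ≤ 0# →
    ρ₁ + ι 2 * e - c ≤ ι 11 + ι 2 * β → ρ₂ + ι 2 * e - c ≤ ι 11 + ι 2 * β →
    χ + ι 2 * e ≤ ι 5 + ι 2 * β → ι 2 * e ≤ ι 6 + ι 2 * β →
    ρ₁ + ρ₂ + I * χ - ι 180 * I * β ≤ ι 2 * c - (ι 1 + ι 180) * I * e + ι 549 * I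
  logarithmic-bound {I} {ρ₁} {ρ₂} {χ} {β} {e} {c} 1≤I e≤0 ρ₁-bound ρ₂-bound χ-bound β-bound = ≤-by _
    (+-nonNeg (+-nonNeg (+-nonNeg (+-nonNeg (x≤y⇒0≤y-x ρ₁-bound) (x≤y⇒0≤y-x ρ₂-bound))
        (*-nonNeg 0≤I (x≤y⇒0≤y-x χ-bound)))
        (*-nonNeg (+-nonNeg (*-nonNeg (ι-nonNeg 178) (x≤y⇒0≤y-x 1≤I)) (ι-nonNeg 174)) (x≤y⇒0≤y-x e≤β+3)))
        (+-nonNeg (*-nonNeg 0≤I (x≤y⇒0≤y-x e≤0)) (*-nonNeg (ι-nonNeg 10) (x≤y⇒0≤y-x 1≤I))))
    (solve 7 (λ I ρ₁ ρ₂ χ β e c →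
      ρ₁ :+ ρ₂ :+ I :* χ :- con (+ 180) :* I :* β :+
        ((con (+ 11) :+ con (+ 2) :* β) :- (ρ₁ :+ con (+ 2) :* e :- c) :+ ((con (+ 11) :+ con (+ 2) :* β) :- (ρ₂ :+ con (+ 2) :* e :- c)) :+
         I :* ((con (+ 5) :+ con (+ 2) :* β) :- (χ :+ con (+ 2) :* e)) :+
         (con (+ 178) :* (I :- con (+ 1)) :+ con (+ 174)) :* (β :+ con (+ 3) :- e) :+
         (I :* (con (+ 0) :- e) :+ con (+ 10) :* (I :- con (+ 1)))) :=
      con (+ 2) :* c :- (con (+ 1) :+ con (+ 180)) :* I :* e :+ con (+ 549) :* I) refl I ρ₁ ρ₂ χ β e c)
    where
    0≤I = ≤-trans (ι-nonNeg 1) 1≤I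
    e≤β+3 : e ≤ β + ι 3
    e≤β+3 = *-cancelˡ-≤ (ι-pos 1) (≤-trans β-bound
      (inj₂ (solve 1 (λ β → con (+ 6) :+ con (+ 2) :* β := con (+ 2) :* (β :+ con (+ 3))) refl β)))

  1≈ι1 : 1# ≈ ι 1
  1≈ι1 = sym (+-identityʳ 1#)

  /δ : ∀ n x → ι n * x / δ ≈ ι (n ℕ.* 15) * x
  /δ n x = /-unique (/-pos 0<1 (ι-pos 14)) (sym (trans (*-congʳ (*-congʳ (ι-* n 15))) (trans
    (solve 4 (λ n k x d → n :* k :* x :* d := n :* x :* (d :* k)) refl (ι n) (ι 15) x δ)
    (trans (*-congˡ (/-cancel (ι-pos 14))) (*-identityʳ _)))))

  log-* : ∀ {r s} I t u v → 0# < r → 0# < s →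
    log₂ (r * s * 2^ (I * u) * 2^ (t * v)) ≈ log₂ r + log₂ s + I * u + t * v
  log-* I t u v 0<r 0<s = trans (log₂-* (*-pos (*-pos 0<r 0<s) (2^-pos _)) (2^-pos _))
    (+-cong (trans (log₂-* (*-pos 0<r 0<s) (2^-pos _)) (+-cong (log₂-* 0<r 0<s) (log₂-2^ _))) (log₂-2^ _))

  -- Logarithms make the four bounds linear, with 2048, 32 and 64 turning into 11, 5 and 6. The
  -- exponent 12 I/δ is 180 I.
  log-bound : ∀ {I η r₁ r₂ c B} C → 1# ≤ I → 0# < η → η ≤ 1# →
    0# < r₁ → 0# < r₂ → 0# < c → 0# < B →
    r₁ * (η * η) * half^ C ≤ ι 2048 * (B * B) → r₂ * (η * η) * half^ C ≤ ι 2048 * (B * B) →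
    c * (η * η) ≤ ι 32 * (B * B) → η * η ≤ ι 64 * (B * B) →
    log₂ (r₁ * r₂ * c ^ I * B ^ (- (ι 12 * I / δ))) ≤
    ι (2 ℕ.* C) - (1# + ι 12 / δ) * I * log₂ η + ι 549 * I
  log-bound {I} {η} {r₁} {r₂} {c} {B} C 1≤I 0<η η≤1 0<r₁ 0<r₂ 0<c 0<B r₁-bound r₂-bound c-bound B-bound = ≤-trans
    (inj₂ (trans (log-* I _ _ _ 0<r₁ 0<r₂) (+-congˡ (trans (*-congʳ (-‿cong (/δ 12 I))) (sym (-‿distribˡ-* _ _))))))
    (≤-trans (logarithmic-bound (≤-resp-≈ 1≈ι1 refl 1≤I) logε≤0
        (log-ratio 0<r₁ r₁-bound) (log-ratio 0<r₂ r₂-bound) log-c log-B)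
      (inj₂ (+-congʳ (+-cong (sym (ι-* 2 C)) (-‿cong (*-congʳ (*-congʳ (+-cong (sym 1≈ι1)
        (trans (sym (*-identityʳ _)) (trans (sym (/δ 12 1#)) (*-congʳ (*-identityʳ _))))))))))))
    where
    e = log₂ η
    β = log₂ B
    0<εε = *-pos 0<η 0<η
    logε≤0 : e ≤ 0#
    logε≤0 = ≤-trans (log₂-mono-≤ 0<η (≤-trans η≤1 (inj₂ 1≈ι1))) (inj₂ (log₂-ι 0))
    log-2^n*BB : ∀ n → 0# < ι (2 ℕ.^ n) → log₂ (ι (2 ℕ.^ n) * (B * B)) ≈ ι n + ι 2 * β
    log-2^n*BB n 0<2^n = trans (log₂-* 0<2^n (*-pos 0<B 0<B)) (+-cong (log₂-ι n) (log-square 0<B))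
    log-ratio : ∀ {r} → 0# < r → r * (η * η) * half^ C ≤ ι 2048 * (B * B) →
                log₂ r + ι 2 * e - ι C ≤ ι 11 + ι 2 * β
    log-ratio 0<r le = ≤-resp-≈
      (trans (log₂-* (*-pos 0<r 0<εε) (half^-pos C))
        (+-cong (trans (log₂-* 0<r 0<εε) (+-congˡ (log-square 0<η))) (log-half^ C)))
      (log-2^n*BB 11 (ι-pos 2047)) (log₂-mono-≤ (*-pos (*-pos 0<r 0<εε) (half^-pos C)) le)
    log-c : log₂ c + ι 2 * e ≤ ι 5 + ι 2 * β
    log-c = ≤-resp-≈ (trans (log₂-* 0<c 0<εε) (+-congˡ (log-square 0<η)))
      (log-2^n*BB 5 (ι-pos 31)) (log₂-mono-≤ (*-pos 0<c 0<εε) c-bound)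
    log-B : ι 2 * e ≤ ι 6 + ι 2 * β
    log-B = ≤-resp-≈ (log-square 0<η) (log-2^n*BB 6 (ι-pos 63)) (log₂-mono-≤ 0<εε B-bound)

-- Infima, suprema and guarded values in the extended reals.

module ExtendedReals (ℝ : RealNumbers) where

  open RealNumbers ℝ
  open MarginalInformation ℝ
  open ExtendedOrder _≤_ using (_≤⊤±)

  if-true : ∀ {P : Set} {v} (P? : Dec P) → P → ([ v ]if P? else+∞) ≡ [ v ]
  if-true (yes _) _ = ≡.refl
  if-true (no ¬p) p = contradiction p ¬p

  ≤-if : ∀ {P : Set} {u v} (P? : Dec P) → (P → u ≤± [ v ]) → u ≤± ([ v ]if P? else+∞)
  ≤-if (yes p) u≤v = u≤v p
  ≤-if (no _)  _   = _ ≤⊤±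

  ⨆-least : ∀ (em : ExcludedMiddle 0ℓ) (X : Pred (Carrier ±) 0ℓ) {v} → IsUpperBound X v → ⨆ em X ≤± v
  ⨆-least em X {v} = proj₂ (proj₂ (supremum em X)) v

  ⨅-lower : ∀ (em : ExcludedMiddle 0ℓ) (X : Pred (Carrier ±) 0ℓ) {w} → X w → ⨅ em X ≤± w
  ⨅-lower em X {w} = proj₁ (proj₂ (infimum em X)) w

-- The tilted distribution q and the bound on its cost.

module Tilting (ℝ : RealNumbers) where

  open RealNumbers ℝ
  open MarginalInformation ℝ
  open OrderedField ℝ
  open FiniteSums ℝ
  open Rectangles ℝ
  open Kraft ℝ
  open Probability ℝ
  open Numerics ℝ
  open ExtendedReals ℝ
  open ExtendedOrder _≤_ using (≤±-trans) renaming ([_] to [_]≤)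

  module _ {a b k T L : ℕ} (f : Fin a → Fin b → Bool) (p : Distribution a b k T L)
           (protocol : IsProtocol p) (C : ℕ) (complexity : HasCommunicationComplexity p C) where

    private
      M = Transcript k T L
      ms = allTranscripts k T L

    weight signed : M → Matrix {a} {b}
    weight m x y = mass p (x , y , m)
    signed m x y = mass p (x , y , m) * sign {a} {b} {k} {T} {L} (f x y)

    total-weight total-signed : M → Carrier
    total-weight m = ⟪ weight m ∣ (λ _ → 1#) , (λ _ → 1#) ⟫
    total-signed m = ⟪ signed m ∣ (λ _ → 1#) , (λ _ → 1#) ⟫

    signed≤weight : ∀ m x y → signed m x y ≤ weight m x y
    signed≤weight m x y with f x y
    ... | false = inj₂ (*-identityʳ _)
    ... | true  = ≤-by _ (+-nonNeg 0≤w 0≤w)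
      (trans (+-congʳ (sym (-‿distribʳ-* _ _))) (trans (+-congʳ (-‿cong (*-identityʳ _)))
        (solve 1 (λ w → :- w :+ (w :+ w) := w) refl _)))
      where 0≤w = nonNegative p (x , y , m)

    -signed≤weight : ∀ m x y → - signed m x y ≤ weight m x y
    -signed≤weight m x y with f x y
    ... | true  = inj₂ (trans (-‿distribʳ-* _ _) (trans (*-congˡ (-‿involutive 1#)) (*-identityʳ _)))
    ... | false = ≤-by _ (+-nonNeg 0≤w 0≤w) (trans (+-congʳ (-‿cong (*-identityʳ _)))
        (solve 1 (λ w → :- w :+ (w :+ w) := w) refl _))
      where 0≤w = nonNegative p (x , y , m)

    total-weight≈ℙ : ∀ m → total-weight m ≈ ℙ p ⟨m= m ⟩
    total-weight≈ℙ m = trans ⟪⟫-∑ (trans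
      (∑-cong (allFin a) λ x → ∑-cong (allFin b) λ y → trans (*-congˡ (*-identityˡ 1#)) (*-identityʳ _))
      (sym (ℙ-m p m)))

    -- The absolute value of `total-signed m`. It is the unnormalised reweighted probability of `m`,
    -- and its sum over `ms` is `advantage p f` by definition.
    H : M → Carrier
    H m = ℙ p ⟨m= m ⟩ * ∣ bias p f m ∣

    H-nonNeg : ∀ m → 0# ≤ H m
    H-nonNeg m = *-nonNeg (ℙ-nonNeg p ⟨m= m ⟩) (∣∣-nonNeg _)

    H²≈signed² : ∀ m → 0# < ℙ p ⟨m= m ⟩ → H m * H m ≈ total-signed m * total-signed m
    H²≈signed² m 0<m = trans
      (solve 2 (λ w b → w :* b :* (w :* b) := b :* b :* (w :* w)) refl (ℙ p ⟨m= m ⟩) ∣ bias p f m ∣)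
      (trans (*-congʳ (∣∣-square _)) (trans
        (solve 2 (λ w b → b :* b :* (w :* w) := b :* w :* (b :* w)) refl (ℙ p ⟨m= m ⟩) (bias p f m))
        (*-cong bias≈ bias≈)))
      where
      bias≈ : bias p f m * ℙ p ⟨m= m ⟩ ≈ total-signed m
      bias≈ = trans (bias-ℙ p f m 0<m) (sym (trans ⟪⟫-∑
        (∑-cong (allFin a) λ x → ∑-cong (allFin b) λ y → trans (*-congˡ (*-identityˡ 1#)) (*-identityʳ _))))

    H≤ℙ : ∀ m → H m ≤ ℙ p ⟨m= m ⟩
    H≤ℙ m = cases (0# <? ℙ p ⟨m= m ⟩)
      where
      cases : Dec (0# < ℙ p ⟨m= m ⟩) → H m ≤ ℙ p ⟨m= m ⟩
      cases (yes 0<m) = square-mono⁻¹ (inj₁ 0<m) (≤-resp-≈ (sym (H²≈signed² m 0<m))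
        (*-cong (total-weight≈ℙ m) (total-weight≈ℙ m))
        (⨯-∣∣-≤ (signed≤weight m) (-signed≤weight m) (λ _ → true) (λ _ → true)))
      cases (no 0≮m) = inj₂ (trans (*-congʳ m≈0) (trans (zeroˡ _) (sym m≈0)))
        where m≈0 = ≤-antisym (≮⇒≥ 0≮m) (ℙ-nonNeg p ⟨m= m ⟩)

    advantage≤1 : advantage p f ≤ 1#
    advantage≤1 = ≤-trans (∑-mono ms H≤ℙ) (inj₂ (∑-ℙm p))

    occurs : M → Bool
    occurs m = does (0# <? ℙ p ⟨m= m ⟩)

    -- For each value of m₀ the possible message sequences satisfy Kraft's inequality and have at
    -- most `C` bits, so they contribute at most p(m₀) in all.
    ∑-occurs≤1 : ∑ ms (λ m → 𝟙 (occurs m) * (ℙ p ⟨m≤ 0 ∶ m ⟩ * half^ C)) ≤ 1#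
    ∑-occurs≤1 = ≤-trans (inj₂ (∑-cartesianProductWith _,_ (allFin k) vecs _))
      (≤-trans (∑-mono (allFin k) per-seed) (inj₂ (∑-ℙm₀ p (Vec.replicate T ε))))
      where
      vecs = allVecs (allMessages L) T
      -- Agreement up to 0 compares m₀ alone, so the empty messages are placeholders and the event
      -- is the same for every `(r , v)`.
      seed : Fin k → Carrier
      seed r = ℙ p ⟨m≤ 0 ∶ (r , Vec.replicate T ε) ⟩
      term : ∀ r v → 𝟙 (occurs (r , v)) * (seed r * half^ C) ≤ seed r * (𝟙 (occurs (r , v)) * half^ vecLength v)
      term r v with 0# <? ℙ p ⟨m= (r , v) ⟩
      ... | no  _   = inj₂ (trans (zeroˡ _) (sym (trans (*-congˡ (zeroˡ _)) (zeroʳ _))))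
      ... | yes 0<m = ≤-trans (inj₂ (*-identityˡ _)) (*-monoˡ-≤ (ℙ-nonNeg p _)
        (≤-trans (half^-antitone (HasCommunicationComplexity.bound complexity (r , v) 0<m)) (inj₂ (sym (*-identityˡ _)))))
      per-seed : ∀ r → ∑ vecs (λ v → 𝟙 (occurs (r , v)) * (seed r * half^ C)) ≤ seed r
      per-seed r = ≤-trans (∑-mono vecs (term r)) (≤-trans (inj₂ (∑-*ˡ vecs (seed r) _))
        (≤-trans (*-monoˡ-≤ (ℙ-nonNeg p _) (kraft T (λ v → occurs (r , v)) λ v v′ i Uv Uv′ eq →
            IsProtocol.prefixFree protocol (r , v) (r , v′) i
              (does⇒ (0# <? ℙ p ⟨m= (r , v) ⟩) Uv) (does⇒ (0# <? ℙ p ⟨m= (r , v′) ⟩) Uv′) (≡.refl , eq)))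
          (inj₂ (*-identityʳ _))))

    module _ (0<adv : 0# < advantage p f) where

      adv : Carrier
      adv = advantage p f

      -- The inequalities compare `H m / adv`, the reweighted probability, with a quarter of p(m)
      -- and of p(m₀) 2^(-C). If p(m₀) = 0, both read 0 ≤ 0 and no rectangle has positive mass; the
      -- first clause excludes this.
      Kept : M → Set
      Kept m = 0# < ℙ p ⟨m= m ⟩ × adv * ℙ p ⟨m= m ⟩ ≤ ι 4 * H m × adv * (ℙ p ⟨m≤ 0 ∶ m ⟩ * half^ C) ≤ ι 4 * H m

      kept? : ∀ m → Dec (Kept m)
      kept? m = (0# <? _) ×-dec (_ ≤? _) ×-dec (_ ≤? _)

      tilt : M → Carrier
      tilt m = 𝟙 (does (kept? m)) * H m

      tilt-nonNeg : ∀ m → 0# ≤ tilt m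
      tilt-nonNeg m = *-nonNeg (𝟙-nonNeg (does (kept? m))) (H-nonNeg m)

      Z : Carrier
      Z = ∑ ms tilt

      -- A discarded `m` with `H m` positive has 4 H(m) below `adv` times p(m) or `adv` times p(m₀)
      -- 2^(-C). Over the occurring transcripts each of these two sums to at most `adv`, so at most
      -- `adv` / 2 is discarded.
      adv≤2Z : adv ≤ ι 2 * Z
      adv≤2Z = *-cancelˡ-≤ (ι-pos 1) (≤-by _
          (+-nonNeg (x≤y⇒0≤y-x (≤-resp-≈ refl (+-congˡ (*-congˡ (+-congʳ 1≈))) summed))
            (*-nonNeg (inj₁ 0<adv) (x≤y⇒0≤y-x (≤-resp-≈ refl 1≈ ∑-occurs≤1))))
          (solve 3 (λ ε Z K → con (+ 2) :* ε :+ (con (+ 4) :* Z :+ ε :* (con (+ 1) :+ K) :- con (+ 4) :* ε :+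
            ε :* (con (+ 1) :- K)) := con (+ 2) :* (con (+ 2) :* Z)) refl adv Z K))
        where
        1≈ : 1# ≈ ι 1
        1≈ = sym (+-identityʳ 1#)
        K = ∑ ms (λ m → 𝟙 (occurs m) * (ℙ p ⟨m≤ 0 ∶ m ⟩ * half^ C))
        extra : M → Carrier
        extra m = 𝟙 (occurs m) * (ℙ p ⟨m≤ 0 ∶ m ⟩ * half^ C)
        extra-nonNeg : ∀ m → 0# ≤ extra m
        extra-nonNeg m = *-nonNeg (𝟙-nonNeg (occurs m)) (*-nonNeg (ℙ-nonNeg p ⟨m≤ 0 ∶ m ⟩) (inj₁ (half^-pos C)))
        term : ∀ m → ι 4 * H m ≤ ι 4 * tilt m + adv * (ℙ p ⟨m= m ⟩ + extra m)
        -- A discarded `m` of positive probability fails one of the two thresholds; the third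
        -- argument decides which. The equations let the indicators in `tilt` and `extra` be
        -- evaluated.
        term m = cases (kept? m) (0# <? ℙ p ⟨m= m ⟩) (_ ≤? _) ≡.refl ≡.refl
          where
          P = ℙ p ⟨m= m ⟩
          Q = ℙ p ⟨m≤ 0 ∶ m ⟩ * half^ C
          0≤P = ℙ-nonNeg p ⟨m= m ⟩
          slack : ∀ {h} → h ≤ adv * (P + extra m) → h ≤ ι 4 * tilt m + adv * (P + extra m)
          slack le = ≤-trans le (≤-trans (inj₂ (sym (+-identityˡ _)))
            (+-mono-≤ (*-nonNeg (ι-nonNeg 4) (tilt-nonNeg m)) ≤-refl))
          cases : (K? : Dec (Kept m)) (P? : Dec (0# < P)) → Dec (adv * P ≤ ι 4 * H m) → kept? m ≡ K? → (0# <? P) ≡ P? →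
                  ι 4 * H m ≤ ι 4 * tilt m + adv * (P + extra m)
          cases (yes _) _ _ eq _ = ≤-by _ (*-nonNeg (inj₁ 0<adv) (+-nonNeg 0≤P (extra-nonNeg m)))
            (+-congʳ (*-congˡ (trans (sym (*-identityˡ _)) (*-congʳ (reflexive (≡.cong (λ d → 𝟙 (does d)) (≡.sym eq)))))))
          cases (no _) (no 0≮P) _ _ _ = ≤-trans (inj₂ (trans (*-congˡ H≈0) (zeroʳ _)))
            (slack (*-nonNeg (inj₁ 0<adv) (+-nonNeg 0≤P (extra-nonNeg m))))
            where
            H≈0 : H m ≈ 0#
            H≈0 = ≤-antisym (≤-trans (H≤ℙ m) (≮⇒≥ 0≮P)) (H-nonNeg m)
          cases (no ¬kept) (yes 0<P) (no 4H<εP) _ eq = slack (≤-trans (≮⇒≥ λ lt → 4H<εP (inj₁ lt)) (*-monoˡ-≤ (inj₁ 0<adv)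
            (≤-by _ (extra-nonNeg m) refl)))
          cases (no ¬kept) (yes 0<P) (yes εP≤4H) _ eq = slack (≤-trans (≮⇒≥ λ lt → ¬kept (0<P , εP≤4H , inj₁ lt)) (*-monoˡ-≤ (inj₁ 0<adv)
            (≤-trans (≤-by P 0≤P (+-comm _ _)) (+-monoʳ-≤ P (inj₂ (sym (trans
              (*-congʳ (reflexive (≡.cong (λ d → 𝟙 (does d)) eq))) (*-identityˡ _))))))))
        summed : ι 4 * adv ≤ ι 4 * Z + adv * (1# + K)
        summed = ≤-resp-≈ (∑-*ˡ ms (ι 4) H)
          (trans (∑-+ ms _ _) (+-cong (∑-*ˡ ms (ι 4) tilt)
            (trans (∑-*ˡ ms adv _) (*-congˡ (trans (∑-+ ms _ _) (+-congʳ (∑-ℙm p)))))))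
          (∑-mono ms term)

      0<Z : 0# < Z
      0<Z = *-cancelˡ-pos (ι-nonNeg 2) (<-≤-trans 0<adv adv≤2Z)

      -- A discarded transcript has no useful rectangle and receives `κ` = 0, so that q vanishes
      -- there. The properties of the rectangle are therefore promised only for positive `κ`, which
      -- is what the support of q provides.
      record Piece (m : M) : Set where
        field
          S : Fin a → Bool
          T′ : Fin b → Bool
          κ : Carrier
          κ-nonNeg : 0# ≤ κ
          κ-mass : κ * ⟪ weight m ∣ S ⨯ T′ ⟫ ≈ tilt m
          κ-pos : 0# < κ → Kept m × tilt m ≈ H m ×
            DenseHeavy (weight m) (signed m) (λ x → ℙ p ⟨x= x ⟩) (λ y → ℙ p ⟨y= y ⟩)
              (total-signed m) (total-weight m) S T′

      Kept⇒0<H : ∀ {m} → Kept m → 0# < H m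
      Kept⇒0<H (0<m , εW≤4H , _) = *-cancelˡ-pos (ι-nonNeg 4) (<-≤-trans (*-pos 0<adv 0<m) εW≤4H)

      opaque
        piece : ∀ m → Piece m
        piece m = make (kept? m) ≡.refl
          where
          make : (d : Dec (Kept m)) → kept? m ≡ d → Piece m
          make (no _) eq = record
            { S = λ _ → true ; T′ = λ _ → true ; κ = 0# ; κ-nonNeg = ≤-refl
            ; κ-mass = trans (zeroˡ _) (sym (trans (*-congʳ (reflexive (≡.cong (λ d → 𝟙 (does d)) eq))) (zeroˡ _)))
            ; κ-pos = λ 0<0 → contradiction 0<0 (irrefl refl) }
          make (yes kept@(0<m , _)) eq = from (dense-heavy-rectangle
              (λ x y → nonNegative p (x , y , m)) (signed≤weight m) (-signed≤weight m)
              (λ x → ℙ-nonNeg p ⟨x= x ⟩) (∑-ℙx p) (λ y → ℙ-nonNeg p ⟨y= y ⟩) (∑-ℙy p)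
              (<-respʳ-≈ (H²≈signed² m 0<m) (*-pos (Kept⇒0<H {m} kept) (Kept⇒0<H {m} kept))))
            where
            tilt≈H : tilt m ≈ H m
            tilt≈H = trans (*-congʳ (reflexive (≡.cong (λ d → 𝟙 (does d)) eq))) (*-identityˡ _)
            from : ∃₂ (DenseHeavy (weight m) (signed m) (λ x → ℙ p ⟨x= x ⟩) (λ y → ℙ p ⟨y= y ⟩)
                        (total-signed m) (total-weight m)) → Piece m
            from (S , T′ , heavy@(0<μ , _)) = record
              { S = S ; T′ = T′ ; κ = H m / ⟪ weight m ∣ S ⨯ T′ ⟫
              ; κ-nonNeg = inj₁ (/-pos (Kept⇒0<H {m} kept) 0<μ)
              ; κ-mass = trans (/-cancel 0<μ) (sym tilt≈H)
              ; κ-pos = λ _ → kept , tilt≈H , heavy }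

      module Pieces (m : M) = Piece (piece m)
      open Pieces

      -- This is q(xym)/p(xym) on the support of q. By `κ-mass` it compensates for the mass of the
      -- rectangle, so that q(m) is `tilt m / Z` whichever rectangle was chosen.
      scale : M → Carrier
      scale m = κ m / Z

      side : M → Matrix {a} {b}
      side m x y = 𝟙 (S m x) * 𝟙 (T′ m y)

      μ : M → Carrier
      μ m = ⟪ weight m ∣ S m ⨯ T′ m ⟫

      tilted-mass : Outcome a b k T L → Carrier
      tilted-mass (x , y , m) = weight m x y * side m x y * scale m

      scale-nonNeg : ∀ m → 0# ≤ scale m
      scale-nonNeg m = *-nonNeg (κ-nonNeg m) (inj₁ (⁻¹-pos 0<Z))

      ∑-tilted : ∀ m → ∑ (allFin a) (λ x → ∑ (allFin b) λ y → tilted-mass (x , y , m)) ≈ μ m * scale m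
      ∑-tilted m = trans (trans (∑-cong (allFin a) λ x → ∑-*ʳ (allFin b) _ (scale m)) (∑-*ʳ (allFin a) _ (scale m)))
        (*-congʳ (sym ⟪⟫-∑))

      μ*scale : ∀ m → μ m * scale m ≈ tilt m / Z
      μ*scale m = trans (solve 3 (λ μ κ z → μ :* (κ :* z) := κ :* μ :* z) refl (μ m) (κ m) (Z ⁻¹)) (*-congʳ (κ-mass m))

      tilted-total : ∑ (allOutcomes a b k T L) tilted-mass ≈ 1#
      tilted-total = trans (∑-cartesianProductWith _,_ (allFin a) _ tilted-mass) (trans
        (∑-cong (allFin a) λ x → trans (∑-cartesianProductWith _,_ (allFin b) ms _) (∑-swap (allFin b) ms _))
        (trans (∑-swap (allFin a) ms _) (trans
          (∑-cong ms λ m → trans (∑-tilted m) (μ*scale m))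
          (trans (∑-*ʳ ms tilt (Z ⁻¹)) (x*x⁻¹≈1 0<Z)))))

      tilted : Distribution a b k T L
      tilted = record
        { mass = tilted-mass
        ; nonNegative = λ { (x , y , m) → *-nonNeg (*-nonNeg (nonNegative p (x , y , m))
            (*-nonNeg (𝟙-nonNeg (S m x)) (𝟙-nonNeg (T′ m y)))) (scale-nonNeg m) }
        ; total = tilted-total }

      -- Both the protocol and the indicator of a rectangle split into a part for x and a part for
      -- y; the factors that depend on `m` alone are put on the side of y.
      tilted-rectangular : IsRectangular tilted (λ x y → ℙ p (⟨x= x ⟩ ∩ ⟨y= y ⟩))
      tilted-rectangular = (λ x m → alice p x m * 𝟙 (S m x))
        , (λ y m → ℙ p ⟨m≤ 0 ∶ m ⟩ * bob p y m * 𝟙 (T′ m y) * scale m)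
        , λ x y m → trans (*-congʳ (*-congʳ (mass-factors protocol x y m)))
          (solve 7 (λ g M A B s t c → g :* M :* (A :* B) :* (s :* t) :* c := g :* (A :* s) :* (M :* B :* t :* c))
            refl (ℙ p (⟨x= x ⟩ ∩ ⟨y= y ⟩)) (ℙ p ⟨m≤ 0 ∶ m ⟩) (alice p x m) (bob p y m)
            (𝟙 (S m x)) (𝟙 (T′ m y)) (scale m))

      module _ {x y m} (0<q : 0# < tilted-mass (x , y , m)) where

        private
          w = weight m x y
          c = scale m
          q = tilted
          0<wside : 0# < w * side m x y
          0<wside = *-cancelʳ-pos (scale-nonNeg m) 0<q

        0<weight : 0# < w
        0<weight = *-cancelʳ-pos (*-nonNeg (𝟙-nonNeg (S m x)) (𝟙-nonNeg (T′ m y))) 0<wside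

        0<side : 0# < side m x y
        0<side = *-cancelˡ-pos (inj₁ 0<weight) 0<wside

        0<scale : 0# < c
        0<scale = *-cancelˡ-pos (inj₁ 0<wside) 0<q

        𝟙-pos : ∀ {b} → 0# < 𝟙 b → b ≡ true
        𝟙-pos {true}  _   = ≡.refl
        𝟙-pos {false} 0<0 = contradiction 0<0 (irrefl refl)

        x∈S : S m x ≡ true
        x∈S = 𝟙-pos (*-cancelʳ-pos (𝟙-nonNeg (T′ m y)) 0<side)

        y∈T : T′ m y ≡ true
        y∈T = 𝟙-pos (*-cancelˡ-pos (𝟙-nonNeg (S m x)) 0<side)

        tilted≈ : tilted-mass (x , y , m) ≈ w * c
        tilted≈ = *-congʳ (trans (*-congˡ (trans
          (*-cong (reflexive (≡.cong 𝟙 x∈S)) (reflexive (≡.cong 𝟙 y∈T))) (*-identityˡ 1#))) (*-identityʳ w))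

        ℙ-ym-tilted : ℙ q (⟨y= y ⟩ ∩ ⟨m= m ⟩) ≈ ∑ (allFin a) (λ x → weight m x y * 𝟙 (S m x)) * c
        ℙ-ym-tilted = trans (ℙ-ym q y m) (trans (∑-*ʳ (allFin a) _ c) (*-congʳ (∑-cong (allFin a) λ x →
          *-congˡ (trans (*-congˡ (reflexive (≡.cong 𝟙 y∈T))) (*-identityʳ _)))))

        ℙ-xm-tilted : ℙ q (⟨x= x ⟩ ∩ ⟨m= m ⟩) ≈ ∑ (allFin b) (λ y → weight m x y * 𝟙 (T′ m y)) * c
        ℙ-xm-tilted = trans (ℙ-xm q x m) (trans (∑-*ʳ (allFin b) _ c) (*-congʳ (∑-cong (allFin b) λ y →
          *-congˡ (trans (*-congʳ (reflexive (≡.cong 𝟙 x∈S))) (*-identityˡ _)))))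

        properties = κ-pos m (*-cancelʳ-pos (inj₁ (⁻¹-pos 0<Z)) 0<scale)

        kept : Kept m
        kept = proj₁ properties

        heavy : DenseHeavy (weight m) (signed m) (λ x → ℙ p ⟨x= x ⟩) (λ y → ℙ p ⟨y= y ⟩)
                  (total-signed m) (total-weight m) (S m) (T′ m)
        heavy = proj₂ (proj₂ properties)

        0<H : 0# < H m
        0<H = Kept⇒0<H {m} kept

        0<μ : 0# < μ m
        0<μ = proj₁ heavy

        0<ℙxy : 0# < ℙ p (⟨x= x ⟩ ∩ ⟨y= y ⟩)
        0<ℙxy = <-≤-trans 0<weight (mass≤ℙ p (⟨x= x ⟩ ∩ ⟨y= y ⟩) {x , y , m}
          (∩-intro ⟨x= x ⟩ ⟨y= y ⟩ {x , y , m} (⟨x⟩-intro x y m) (⟨y⟩-intro x y m)))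

        ℙyx≈ℙxy : ℙ p (⟨y= y ⟩ ∩ ⟨x= x ⟩) ≈ ℙ p (⟨x= x ⟩ ∩ ⟨y= y ⟩)
        ℙyx≈ℙxy = ∑-cong (allOutcomes a b k T L) λ ω →
          reflexive (≡.cong (λ d → if d then mass p ω else 0#) (Bool.∧-comm (⟨y= y ⟩ ω) (⟨x= x ⟩ ω)))

        0<ℙx : 0# < ℙ p ⟨x= x ⟩
        0<ℙx = <-≤-trans 0<weight (mass≤ℙ p ⟨x= x ⟩ {x , y , m} (⟨x⟩-intro x y m))

        0<ℙy : 0# < ℙ p ⟨y= y ⟩
        0<ℙy = <-≤-trans 0<weight (mass≤ℙ p ⟨y= y ⟩ {x , y , m} (⟨y⟩-intro x y m))

        -- The heaviness of column `y` bounds q(ym) from below and p(xym) ≤ p(xy) p(m₀) bounds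
        -- q(xym) from above, each up to the common factor `scale m`, which cancels.
        ratio-x : let r = ℙ[ ⟨x= x ⟩ ∣ ⟨y= y ⟩ ∩ ⟨m= m ⟩ ]of q / ℙ[ ⟨x= x ⟩ ∣ ⟨y= y ⟩ ]of p in
          0# < r × r * μ m ≤ ι 32 * ℙ p ⟨m≤ 0 ∶ m ⟩
        ratio-x = conditional-ratio (trans (ℙ-xym q x y m) tilted≈) ℙ-ym-tilted 0<scale 0<weight 0<ℙxy 0<ℙy 0<μ
          (mass≤ℙxy*ℙm₀ protocol x y m) (proj₂ (proj₂ (proj₂ heavy)) y y∈T)

        ratio-y : let r = ℙ[ ⟨y= y ⟩ ∣ ⟨x= x ⟩ ∩ ⟨m= m ⟩ ]of q / ℙ[ ⟨y= y ⟩ ∣ ⟨x= x ⟩ ]of p in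
          0# < r × r * μ m ≤ ι 32 * ℙ p ⟨m≤ 0 ∶ m ⟩
        ratio-y = conditional-ratio (trans (ℙ-yxm q x y m) tilted≈) ℙ-xm-tilted 0<scale 0<weight
          (<-respʳ-≈ (sym ℙyx≈ℙxy) 0<ℙxy) 0<ℙx 0<μ
          (≤-trans (mass≤ℙxy*ℙm₀ protocol x y m) (inj₂ (*-congʳ (sym ℙyx≈ℙxy))))
          (proj₁ (proj₂ (proj₂ heavy)) x x∈S)

        mass-ratio : tilted-mass (x , y , m) / w ≈ c
        mass-ratio = /-unique 0<weight (trans tilted≈ (*-comm w c))

        -- Here `c` is H(m)/(μ Z), and `Z` is at least half of `adv`.
        scale-bound : c * adv * μ m ≤ ι 2 * H m
        scale-bound = R.begin
          c * adv * μ m            R.≈⟨ solve 3 (λ c ε μ → c :* ε :* μ := μ :* c :* ε) refl c adv (μ m) ⟩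
          μ m * c * adv            R.≈⟨ *-congʳ (trans (μ*scale m) (*-congʳ (proj₁ (proj₂ properties)))) ⟩
          H m / Z * adv            R.≤⟨ *-monoˡ-≤ (inj₁ (/-pos 0<H 0<Z)) adv≤2Z ⟩
          H m / Z * (ι 2 * Z)     R.≈⟨ solve 3 (λ h t z → h :* (t :* z) := t :* (h :* z)) refl (H m / Z) (ι 2) Z ⟩
          ι 2 * (H m / Z * Z)     R.≈⟨ *-congˡ (/-cancel 0<Z) ⟩
          ι 2 * H m               R.∎

        B : Carrier
        B = ∣ bias q f m ∣

        E : Carrier
        E = ⟪ signed m ∣ S m ⨯ T′ m ⟫

        ℙm-tilted : ℙ q ⟨m= m ⟩ ≈ μ m * c
        ℙm-tilted = trans (ℙ-m q m) (∑-tilted m)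

        -- Given `m`, q is p conditioned on the rectangle: the factor `c` is constant there and
        -- cancels.
        bias*μ : bias q f m * μ m ≈ E
        bias*μ = ≤-antisym (*-cancelˡ-≤ 0<scale (inj₂ scaled)) (*-cancelˡ-≤ 0<scale (inj₂ (sym scaled)))
          where
          scaled : c * (bias q f m * μ m) ≈ c * E
          scaled = trans (solve 3 (λ c b μ → c :* (b :* μ) := b :* (μ :* c)) refl c (bias q f m) (μ m)) (trans
            (*-congˡ (sym ℙm-tilted)) (trans
            (bias-ℙ q f m (<-respʳ-≈ (sym ℙm-tilted) (*-pos 0<μ 0<scale))) (trans
            (∑-cong (allFin a) λ x′ → trans (∑-cong (allFin b) λ y′ →
              solve 4 (λ w u c s → w :* u :* c :* s := w :* s :* u :* c) refl
                (weight m x′ y′) (side m x′ y′) c (sign {a} {b} {k} {T} {L} (f x′ y′)))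
              (∑-*ʳ (allFin b) _ c)) (trans
            (∑-*ʳ (allFin a) _ c) (trans (*-congʳ (sym ⟪⟫-∑)) (*-comm E c))))))

        E²≈ : E * E ≈ B * B * (μ m * μ m)
        E²≈ = trans (*-cong (sym bias*μ) (sym bias*μ)) (trans
          (solve 2 (λ b μ → b :* μ :* (b :* μ) := b :* b :* (μ :* μ)) refl (bias q f m) (μ m))
          (*-congʳ (sym (∣∣-square _))))

        dense : H m * H m * μ m ≤ ι 4 * (B * B * (μ m * μ m)) * ℙ p ⟨m= m ⟩
        dense = ≤-resp-≈ (*-congʳ (sym (H²≈signed² m (proj₁ kept))))
          (*-cong (*-congˡ E²≈) (total-weight≈ℙ m)) (proj₁ (proj₂ heavy))

        μ≤ℙm : μ m ≤ ℙ p ⟨m= m ⟩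
        μ≤ℙm = ≤-trans (⟪⟫-mono λ x y → *-monoˡ-≤ (nonNegative p (x , y , m))
            (*-mono-≤ (𝟙-nonNeg (T′ m y)) (inj₁ 0<1) (𝟙≤1 (S m x)) (𝟙≤1 (T′ m y))))
          (inj₂ (total-weight≈ℙ m))

        logCost-bound : ∀ {I} → 1# ≤ I → logCost I p f q (x , y , m) ≤±
          [ ι (2 ℕ.* C) - (1# + ι 12 / δ) * I * log₂ adv + ι 549 * I ]
        logCost-bound {I} 1≤I = ≡.subst (_≤± _)
          -- No value read as +∞ occurs: p(xym) > 0 on the support of q makes the denominators
          -- positive, and `bias-bound` makes `B` positive.
          (≡.sym (if-true ((0# <? _) ×-dec (0# <? _) ×-dec (0# <? _) ×-dec (0# <? _))
            (/-pos 0<ℙxy 0<ℙy , /-pos (<-respʳ-≈ (sym ℙyx≈ℙxy) 0<ℙxy) 0<ℙx , 0<weight , 0<B)))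
          [ log-bound C 1≤I 0<adv advantage≤1
              (proj₁ ratio-x) (proj₁ ratio-y) (<-respʳ-≈ (sym mass-ratio) 0<scale) 0<B
              (Bounds.ratio-bound (proj₁ ratio-x) (proj₂ ratio-x))
              (Bounds.ratio-bound (proj₁ ratio-y) (proj₂ ratio-y))
              (Bounds.mass-ratio-bound (≤-trans (inj₂ (*-congʳ (*-congʳ mass-ratio))) scale-bound))
              Bounds.bias-bound ]≤
          where
          module Bounds = PieceBounds {ε = adv} {ℙ p ⟨m= m ⟩} {H m} {μ m} {B} {ℙ p ⟨m≤ 0 ∶ m ⟩} {half^ C}
            0<adv (proj₁ kept) 0<H 0<μ (proj₁ (proj₂ kept)) (proj₂ (proj₂ kept)) (half^-pos C) μ≤ℙm dense
          0<B : 0# < B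
          0<B = *-cancelˡ-pos (∣∣-nonNeg _)
            (*-cancelˡ-pos (ι-nonNeg 64) (<-≤-trans (*-pos 0<adv 0<adv) Bounds.bias-bound))

      marginalInformation-bound : ∀ (em : ExcludedMiddle 0ℓ) {I} → 1# ≤ I → marginalInformation em I p f ≤±
        [ ι (2 ℕ.* C) - (1# + ι 12 / δ) * I * log₂ adv + ι 549 * I ]
      marginalInformation-bound em 1≤I = ≤±-trans ≤-trans
        (⨅-lower em _ (tilted , tilted-rectangular , ≡.refl))
        (⨆-least em _ λ { _ ((x , y , m) , 0<q , ≡.refl) → logCost-bound {x} {y} {m} 0<q 1≤I })

theorem5 :
    (em : ExcludedMiddle 0ℓ) (ℝ : RealNumbers) →
    let open RealNumbers ℝ
        open MarginalInformation ℝ in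
    Σ[ c ∈ Carrier ] 0# < c ×
      ((I : Carrier) → 1# ≤ I →
       (a b k T L : ℕ) (f : Fin a → Fin b → Bool) (p : Distribution a b k T L) →
       IsProtocol p →
       (C : ℕ) → HasCommunicationComplexity p C →
       marginalInformation em I p f ≤±
         ([ ι (2 ℕ.* C) - (1# + ι 12 / δ) * I * log₂ (advantage p f) + c * I ]if
            0# <? advantage p f else+∞))
-- 549 = 5 + 534 + 10: the constant 5 of q/p enters `I` times, B ≥ ε/8 is used with coefficient 178
-- I - 4 and costs 3 (178 I - 4), and the two ratios cost 2 · 11. The constant terms 22 - 12 = 10
-- are at most 10 I.
theorem5 em ℝ = ι 549 , ι-pos 548 , λ I 1≤I a b k T L f p protocol C complexity →
  -- For advantage 0 the right-hand side is +∞, so only positive advantage is left.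
  ≤-if (0# <? advantage p f) λ 0<adv → marginalInformation-bound f p protocol C complexity 0<adv em 1≤I
  where
  open RealNumbers ℝ
  open MarginalInformation ℝ
  open OrderedField ℝ
  open ExtendedReals ℝ
  open Tilting ℝ
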